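{- $$\limsup_{n \rightarrow \infty} \frac{\iota_{\rm c}(n)}{n} = \frac{1}{4}.$$
   Context: All graphs are finite and simple. For a graph $G$ and $v \in V(G)$, $N[v]$ is the set consisting of $v$ and its neighbours; for $D \subseteq V(G)$, $N[D] = \bigcup_{v \in D} N[v]$, and $G - N[D]$ is the subgraph of $G$ induced by $V(G) \setminus N[D]$. A set $D \subseteq V(G)$ is a cycle isolating set of $G$ if $G - N[D]$ contains no cycle (of any length $\geq 3$). $\iota_{\rm c}(G)$ denotes the size of a smallest cycle isolating set of $G$. For an integer $n \geq 1$, $\iota_{\rm c}(n)$ denotes the maximum of $\iota_{\rm c}(G)$ over all connected graphs $G$ with $V(G) = \{1,\dots,n\}$ and $G \not\simeq K_3$. -}

module Defs where

open import Data.Fin.Base using (Fin; zero; suc; inject₁; fromℕ)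
open import Data.Fin.Properties using (any?; all?; injective⇒≤) renaming (_≟_ to _≟ᶠ_)
open import Data.Fin.Permutation using (↔⇒≡)
open import Data.Fin.Subset using (Subset; _∈_; ∣_∣; ⊤)
open import Data.Fin.Subset.Properties using (_∈?_; anySubset?; ∈⊤; ∣p∣≤n)
open import Data.Integer.Base using (+_)
open import Data.Irrelevant using ([_])
open import Data.List.Base using (List; []; _∷_; allFin)
open import Data.List.Membership.Propositional using () renaming (_∈_ to _∈ˡ_)
open import Data.List.Membership.Propositional.Properties using (∈-allFin)
open import Data.List.Relation.Unary.Any using (here; there)
open import Data.Nat.Base using (ℕ; zero; suc; _≤_; _<_; z≤n; s≤s; NonZero)
open import Data.Nat.Properties
  using (≤-refl; ≤-antisym; ≤-pred; m≤n⇒m≤1+n; m≤n⇒m<n∨m≡n; ≮⇒≥; anyUpTo?; _≤?_)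
  renaming (_≟_ to _≟ⁿ_)
open import Data.Product.Base using (Σ; ∃; _×_; _,_; proj₁; proj₂)
open import Data.Rational.Base using (ℚ; 0ℚ; _/_)
  renaming (_<_ to _<ℚ_; _+_ to _+ℚ_; _-_ to _-ℚ_)
open import Data.Refinement.Base using (Refinement; value; _,_)
open import Data.Sum.Base using (_⊎_; inj₁; inj₂)
open import Data.Vec.Base using (Vec; []; _∷_; lookup; tabulate)
open import Data.Vec.Properties using (lookup∘tabulate; []=⇒lookup; lookup⇒[]=)
open import Function.Base using (id; _∘_; flip)
open import Function.Bundles using (_↔_; _⇔_; mk⇔; Inverse; Injection; module Equivalence)
open import Function.Construct.Identity using (↔-id)
open import Function.Definitions using (Injective)
open import Function.Properties.Inverse using (↔⇒↣)
open import Level using (0ℓ)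
open import Relation.Binary.Construct.Closure.ReflexiveTransitive
  using (Star; ε; _◅_; _◅◅_) renaming (map to Star-map)
open import Relation.Binary.Core using (Rel)
open import Relation.Binary.Definitions using (Decidable; Symmetric; Irreflexive)
open import Relation.Binary.PropositionalEquality
  using (_≡_; _≢_; refl; sym; trans; cong; subst; subst₂; ≢-sym)
open import Relation.Nullary.Decidable
  using (Dec; yes; no; ¬?; map′; recompute; does; dec-true; _×-dec_; _⊎-dec_; _→-dec_)
open import Relation.Nullary.Negation using (¬_; contradiction)
open import Relation.Unary using (Pred)
import Relation.Unary as U

private variable
  V W : Set
  n : ℕ

------------------------------------------------------------------------
-- Graphs

record Graph (V : Set) : Set₁ where
  infix 4 _~_ _~?_
  field
    _~_      : Rel V 0ℓ
    _~?_     : Decidable _~_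
    ~-sym    : Symmetric _~_
    ~-irrefl : Irreflexive _≡_ _~_

record _≅_ (G : Graph V) (H : Graph W) : Set where
  private
    module G = Graph G
    module H = Graph H
  field
    bijection : V ↔ W
  open Inverse bijection public using (to)
  field
    preserves : ∀ u v → u G.~ v ⇔ to u H.~ to v

K : ∀ n → Graph (Fin n)
K n = record
  { _~_      = _≢_
  ; _~?_     = λ u v → ¬? (u ≟ᶠ v)
  ; ~-sym    = ≢-sym
  ; ~-irrefl = λ u≡v u≢v → u≢v u≡v
  }

Connected : Graph V → Set
Connected G = ∀ u v → Star (Graph._~_ G) u v

-- The vertices are pairwise distinct, so the bound on k says that the
-- length suc k is at least 3.
record Cycle (G : Graph V) : Set where
  open Graph G
  field
    {k}       : ℕ
    2≤k       : 2 ≤ k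
    vertex    : Fin (suc k) → V
    injective : Injective _≡_ _≡_ vertex
    step      : ∀ (i : Fin k) → vertex (inject₁ i) ~ vertex (suc i)
    close     : vertex (fromℕ k) ~ vertex zero

-- The proof of P carried by a vertex is irrelevant, so vertices are equal
-- exactly when their values are.
induced : Graph V → (P : Pred V 0ℓ) → Graph (Refinement V P)
induced G P = record
  { _~_      = λ u v → value u ~ value v
  ; _~?_     = λ u v → value u ~? value v
  ; ~-sym    = ~-sym
  ; ~-irrefl = λ u≡v → ~-irrefl (cong value u≡v)
  }
  where open Graph G

------------------------------------------------------------------------
-- Cycle isolation

N[_] : Graph (Fin n) → Fin n → Pred (Fin n) 0ℓ
N[ G ] v u = u ≡ v ⊎ Graph._~_ G v u

⋃N[_] : Graph (Fin n) → Subset n → Pred (Fin n) 0ℓ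
⋃N[ G ] D u = ∃ λ v → v ∈ D × N[ G ] v u

infix 8 _-N[_]
_-N[_] : (G : Graph (Fin n)) (D : Subset n) → Graph (Refinement (Fin n) (λ u → ¬ ⋃N[ G ] D u))
G -N[ D ] = induced G (λ u → ¬ ⋃N[ G ] D u)

CycleIsolating : Graph (Fin n) → Subset n → Set
CycleIsolating G D = ¬ Cycle (G -N[ D ])

IsLeast IsGreatest : ∀ {ℓ} → Pred ℕ ℓ → Pred ℕ ℓ
IsLeast    P k = P k × (∀ m → P m → k ≤ m)
IsGreatest P k = P k × (∀ m → P m → m ≤ k)

IsolatingSize : Graph (Fin n) → Pred ℕ 0ℓ
IsolatingSize G k = ∃ λ D → CycleIsolating G D × ∣ D ∣ ≡ k

private
  least : {P : Pred ℕ 0ℓ} → U.Decidable P → ∀ b → ∃ (λ k → k < b × P k) → ∃ (IsLeast P)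
  least P? (suc b) (k , k<b , Pk) with anyUpTo? P? b
  ... | yes below = least P? b below
  ... | no none with m≤n⇒m<n∨m≡n (≤-pred k<b)
  ...   | inj₁ k<b′ = contradiction (k , k<b′ , Pk) none
  ...   | inj₂ refl = k , Pk , λ m Pm → ≮⇒≥ λ m<k → none (m , m<k , Pm)

  greatest : ∀ {ℓ} {P : Pred ℕ ℓ} → U.Decidable P → ∀ b → (∀ m → P m → m ≤ b) → ∃ P →
             ∃ (IsGreatest P)
  greatest P? b bound w with P? b
  greatest P? b bound w | yes Pb = b , Pb , bound
  greatest P? zero bound (k , Pk) | no ¬Pb with bound k Pk
  ... | z≤n = contradiction Pk ¬Pb
  greatest {P = P} P? (suc b) bound w | no ¬Pb = greatest P? b bound′ w
    where
    bound′ : ∀ m → P m → m ≤ b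
    bound′ m Pm with m≤n⇒m<n∨m≡n (bound m Pm)
    ... | inj₁ m<1+b = ≤-pred m<1+b
    ... | inj₂ refl  = contradiction Pm ¬Pb

  least-unique : {P : Pred ℕ 0ℓ} {k l : ℕ} → IsLeast P k → IsLeast P l → k ≡ l
  least-unique (Pk , k≤) (Pl , l≤) = ≤-antisym (k≤ _ Pl) (l≤ _ Pk)

  anyVec? : {A : Set} → (∀ {P : Pred A 0ℓ} → U.Decidable P → Dec (∃ P)) →
            ∀ m {P : Pred (Vec A m) 0ℓ} → U.Decidable P → Dec (∃ P)
  anyVec? any zero    P? = map′ ([] ,_) (λ { ([] , p) → p }) (P? [])
  anyVec? any (suc m) P? =
    map′ (λ { (x , xs , p) → x ∷ xs , p }) (λ { (x ∷ xs , p) → x , xs , p })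
         (any λ x → anyVec? any m (λ xs → P? (x ∷ xs)))

module _ (G : Graph (Fin n)) where
  open Graph G

  ⋃N? : ∀ D → U.Decidable (⋃N[ G ] D)
  ⋃N? D u = any? λ v → (v ∈? D) ×-dec ((u ≟ᶠ v) ⊎-dec (v ~? u))

  private
    CycleAvoiding : Subset n → ∀ k → Pred (Vec (Fin n) (suc k)) 0ℓ
    CycleAvoiding D k vs =
      2 ≤ k ×
      (∀ i → ¬ ⋃N[ G ] D (lookup vs i)) ×
      (∀ i j → lookup vs i ≡ lookup vs j → i ≡ j) ×
      (∀ (i : Fin k) → lookup vs (inject₁ i) ~ lookup vs (suc i)) ×
      lookup vs (fromℕ k) ~ lookup vs zero

    cycleAvoiding? : ∀ D k → U.Decidable (CycleAvoiding D k)
    cycleAvoiding? D k vs =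
      (2 ≤? k) ×-dec
      (all? λ i → ¬? (⋃N? D (lookup vs i))) ×-dec
      (all? λ i → all? λ j → (lookup vs i ≟ᶠ lookup vs j) →-dec (i ≟ᶠ j)) ×-dec
      (all? λ i → lookup vs (inject₁ i) ~? lookup vs (suc i)) ×-dec
      (lookup vs (fromℕ k) ~? lookup vs zero)

    toCycle : ∀ {D} → ∃ (λ k → k < n × ∃ (CycleAvoiding D k)) → Cycle (G -N[ D ])
    toCycle (k , _ , vs , 2≤k , avoid , inj , step , close) = record
      { 2≤k       = 2≤k
      ; vertex    = λ i → lookup vs i , [ avoid i ]
      ; injective = λ eq → inj _ _ (cong value eq)
      ; step      = step
      ; close     = close
      }

    fromCycle : ∀ {D} → Cycle (G -N[ D ]) → ∃ (λ k → k < n × ∃ (CycleAvoiding D k))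
    fromCycle {D} c =
      k , injective⇒≤ {f = value ∘ vertex} (injective ∘ value-injective) , tabulate f ,
      2≤k ,
      (λ i → subst (¬_ ∘ ⋃N[ G ] D) (sym (eq i)) (avoid (vertex i))) ,
      (λ i j p → injective (value-injective (trans (sym (eq i)) (trans p (eq j))))) ,
      (λ i → subst₂ _~_ (sym (eq (inject₁ i))) (sym (eq (suc i))) (step i)) ,
      subst₂ _~_ (sym (eq (fromℕ k))) (sym (eq zero)) close
      where
      open Cycle c
      f = value ∘ vertex
      eq : ∀ i → lookup (tabulate f) i ≡ f i
      eq = lookup∘tabulate f
      avoid : (u : Refinement (Fin n) (λ u → ¬ ⋃N[ G ] D u)) → ¬ ⋃N[ G ] D (value u)
      avoid (u , [ p ]) = recompute (¬? (⋃N? D u)) p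
      value-injective : {u v : Refinement (Fin n) (λ u → ¬ ⋃N[ G ] D u)} → value u ≡ value v → u ≡ v
      value-injective refl = refl

  cycleIsolating? : U.Decidable (CycleIsolating G)
  cycleIsolating? D =
    ¬? (map′ toCycle fromCycle (anyUpTo? (λ k → anyVec? any? (suc k) (cycleAvoiding? D k)) n))

  isolatingSize? : U.Decidable (IsolatingSize G)
  isolatingSize? k = anySubset? λ D → cycleIsolating? D ×-dec (∣ D ∣ ≟ⁿ k)

  ⊤-isolating : CycleIsolating G ⊤
  ⊤-isolating c with Cycle.vertex c zero
  ... | u , [ p ] = recompute (no id) (p (u , ∈⊤ , inj₁ refl))

  abstract
    ιc-exists : ∃ (IsLeast (IsolatingSize G))
    ιc-exists = least isolatingSize? (suc ∣ ⊤ {n} ∣) (∣ ⊤ {n} ∣ , ≤-refl , ⊤ , ⊤-isolating , refl)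

  ιc : ℕ
  ιc = proj₁ ιc-exists

  ιc-isLeast : IsLeast (IsolatingSize G) ιc
  ιc-isLeast = proj₂ ιc-exists

  private
    -- Reachability using only intermediate vertices from a list.
    Via : List (Fin n) → Rel (Fin n) 0ℓ
    Via []       u v = u ≡ v ⊎ u ~ v
    Via (x ∷ xs) u v = Via xs u v ⊎ (Via xs u x × Via xs x v)

    via? : ∀ xs → Decidable (Via xs)
    via? []       u v = (u ≟ᶠ v) ⊎-dec (u ~? v)
    via? (x ∷ xs) u v = via? xs u v ⊎-dec (via? xs u x ×-dec via? xs x v)

    via-base : ∀ xs {u v} → u ≡ v ⊎ u ~ v → Via xs u v
    via-base []       p = p
    via-base (x ∷ xs) p = inj₁ (via-base xs p)

    via-trans : ∀ xs {u w v} → w ∈ˡ xs → Via xs u w → Via xs w v → Via xs u v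
    via-trans (x ∷ xs) (here refl) p q = inj₂ (into p , from q)
      where
      into : ∀ {u} → Via (x ∷ xs) u x → Via xs u x
      into (inj₁ p)       = p
      into (inj₂ (p , _)) = p
      from : ∀ {v} → Via (x ∷ xs) x v → Via xs x v
      from (inj₁ p)       = p
      from (inj₂ (_ , p)) = p
    via-trans (x ∷ xs) (there w∈) (inj₁ p) (inj₁ q) = inj₁ (via-trans xs w∈ p q)
    via-trans (x ∷ xs) (there w∈) (inj₁ p) (inj₂ (q , r)) = inj₂ (via-trans xs w∈ p q , r)
    via-trans (x ∷ xs) (there w∈) (inj₂ (p , q)) (inj₁ r) = inj₂ (p , via-trans xs w∈ q r)
    via-trans (x ∷ xs) (there w∈) (inj₂ (p , q)) (inj₂ (r , s)) = inj₂ (p , s)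

    fromVia : ∀ xs {u v} → Via xs u v → Star _~_ u v
    fromVia []       (inj₁ refl)    = ε
    fromVia []       (inj₂ p)       = p ◅ ε
    fromVia (x ∷ xs) (inj₁ p)       = fromVia xs p
    fromVia (x ∷ xs) (inj₂ (p , q)) = fromVia xs p ◅◅ fromVia xs q

    toVia : ∀ {u v} → Star _~_ u v → Via (allFin n) u v
    toVia ε = via-base (allFin n) (inj₁ refl)
    toVia (_◅_ {j = w} p ps) =
      via-trans (allFin n) (∈-allFin w) (via-base (allFin n) (inj₂ p)) (toVia ps)

  connected? : Dec (Connected G)
  connected? =
    all? λ u → all? λ v → map′ (fromVia (allFin n)) toVia (via? (allFin n) u v)

≅K? : ∀ {n} (G : Graph (Fin n)) m → Dec (G ≅ K m)
≅K? {n} G m with n ≟ⁿ m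
... | no  n≢m  = no (n≢m ∘ ↔⇒≡ ∘ _≅_.bijection)
... | yes refl = map′ iso complete (all? λ u → all? λ v → ¬? (u ≟ᶠ v) →-dec (u ~? v))
  where
  open Graph G
  iso : (∀ u v → u ≢ v → u ~ v) → G ≅ K n
  iso h = record
    { bijection = ↔-id _
    ; preserves = λ u v → mk⇔ (λ u~v u≡v → ~-irrefl u≡v u~v) (h u v)
    }
  complete : G ≅ K n → ∀ u v → u ≢ v → u ~ v
  complete i u v u≢v = Equivalence.from (preserves u v) (u≢v ∘ Injection.injective (↔⇒↣ bijection))
    where open _≅_ i

------------------------------------------------------------------------
-- The extremal function

-- The values of ιc over the admissible graphs on n vertices, whose maximum is
-- ιcMax n; the vertex set {1,…,n} is represented by Fin n.
ιcValue : ∀ n → ℕ → Set₁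
ιcValue n k = Σ (Graph (Fin n)) λ G → Connected G × ¬ (G ≅ K 3) × ιc G ≡ k

private
  ofMatrix : Vec (Subset n) n → Graph (Fin n)
  ofMatrix M = record
    { _~_      = λ u v → u ≢ v × (u ∈ lookup M v ⊎ v ∈ lookup M u)
    ; _~?_     = λ u v → ¬? (u ≟ᶠ v) ×-dec ((u ∈? lookup M v) ⊎-dec (v ∈? lookup M u))
    ; ~-sym    = λ { (u≢v , inj₁ p) → ≢-sym u≢v , inj₂ p
                   ; (u≢v , inj₂ p) → ≢-sym u≢v , inj₁ p }
    ; ~-irrefl = λ u≡v p → proj₁ p u≡v
    }

  module _ (G H : Graph (Fin n)) where
    private
      module G = Graph G
      module H = Graph H

    isolating-cong : (∀ {u v} → u G.~ v → u H.~ v) → (∀ {u v} → u H.~ v → u G.~ v) →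
                     ∀ {D} → CycleIsolating G D → CycleIsolating H D
    isolating-cong to from {D} iso c = iso record
      { 2≤k       = 2≤k
      ; vertex    = move ∘ vertex
      ; injective = λ eq → injective (move-injective (cong value eq))
      ; step      = from ∘ step
      ; close     = from close
      }
      where
      open Cycle c
      nbhd : ∀ {u} → ⋃N[ G ] D u → ⋃N[ H ] D u
      nbhd (v , v∈D , inj₁ p) = v , v∈D , inj₁ p
      nbhd (v , v∈D , inj₂ p) = v , v∈D , inj₂ (to p)
      move : Refinement (Fin n) (λ u → ¬ ⋃N[ H ] D u) → Refinement (Fin n) (λ u → ¬ ⋃N[ G ] D u)
      move (u , [ p ]) = u , [ p ∘ nbhd ]
      move-injective : ∀ {u v : Refinement (Fin n) (λ u → ¬ ⋃N[ H ] D u)} → value u ≡ value v → u ≡ v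
      move-injective refl = refl

  ιc-cong : (G H : Graph (Fin n)) →
            (∀ {u v} → Graph._~_ G u v → Graph._~_ H u v) →
            (∀ {u v} → Graph._~_ H u v → Graph._~_ G u v) → ιc G ≡ ιc H
  ιc-cong G H to from with ιc-isLeast G
  ... | (D , iso , eq) , min = least-unique
    ((D , isolating-cong G H to from iso , eq) ,
      λ { m (D′ , iso′ , eq′) → min m (D′ , isolating-cong H G from to iso′ , eq′) })
    (ιc-isLeast H)

  ιcValue? : ∀ n → U.Decidable (ιcValue n)
  ιcValue? n k = map′ (λ { (M , p) → ofMatrix M , p }) (λ { (G , p) → matrix G , valid G p })
    (anyVec? anySubset? n λ M →
      connected? (ofMatrix M) ×-dec ¬? (≅K? (ofMatrix M) 3) ×-dec (ιc (ofMatrix M) ≟ⁿ k))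
    where
    module _ (G : Graph (Fin n)) where
      open Graph G
      row : Fin n → Subset n
      row u = tabulate λ v → does (u ~? v)
      matrix : Vec (Subset n) n
      matrix = tabulate row
      entry : ∀ u v → lookup (lookup matrix u) v ≡ does (u ~? v)
      entry u v = trans (cong (flip lookup v) (lookup∘tabulate row u)) (lookup∘tabulate _ v)
      H = ofMatrix matrix
      to : ∀ {u v} → u ~ v → Graph._~_ H u v
      to {u} {v} p =
        (λ u≡v → ~-irrefl u≡v p) ,
        inj₂ (lookup⇒[]= v _ (trans (entry u v) (dec-true (u ~? v) p)))
      mem : ∀ u v → v ∈ lookup matrix u → u ~ v
      mem u v p with u ~? v | trans (sym (entry u v)) ([]=⇒lookup p)
      ... | yes q | _ = q
      ... | no  _ | ()
      from : ∀ {u v} → Graph._~_ H u v → u ~ v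
      from {u} {v} (_ , inj₁ p) = ~-sym (mem v u p)
      from {u} {v} (_ , inj₂ p) = mem u v p
      valid : Connected G × ¬ (G ≅ K 3) × ιc G ≡ k → Connected H × ¬ (H ≅ K 3) × ιc H ≡ k
      valid (conn , notK , eq) =
        (λ u v → Star-map to (conn u v)) ,
        (λ i → notK record
          { bijection = _≅_.bijection i
          ; preserves = λ u v →
              mk⇔ (Equivalence.to (_≅_.preserves i u v) ∘ to)
                  (from ∘ Equivalence.from (_≅_.preserves i u v))
          }) ,
        trans (sym (ιc-cong G H to from)) eq

  star : ∀ n → Graph (Fin (suc n))
  star n = record
    { _~_      = λ u v → (u ≡ zero × v ≢ zero) ⊎ (u ≢ zero × v ≡ zero)
    ; _~?_     = λ u v → ((u ≟ᶠ zero) ×-dec ¬? (v ≟ᶠ zero)) ⊎-dec (¬? (u ≟ᶠ zero) ×-dec (v ≟ᶠ zero))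
    ; ~-sym    = λ { (inj₁ (p , q)) → inj₂ (q , p) ; (inj₂ (p , q)) → inj₁ (q , p) }
    ; ~-irrefl = λ { refl (inj₁ (p , q)) → q p ; refl (inj₂ (p , q)) → p q }
    }

  star-connected : ∀ n → Connected (star n)
  star-connected n u v = toCentre u ◅◅ fromCentre v
    where
    open Graph (star n)
    toCentre : ∀ u → Star _~_ u zero
    toCentre zero    = ε
    toCentre (suc u) = inj₂ ((λ ()) , refl) ◅ ε
    fromCentre : ∀ u → Star _~_ zero u
    fromCentre zero    = ε
    fromCentre (suc u) = inj₁ (refl , λ ()) ◅ ε

  star≇K₃ : ∀ n → ¬ (star n ≅ K 3)
  star≇K₃ n i with ↔⇒≡ (_≅_.bijection i)
  ... | refl with Equivalence.from (_≅_.preserves i (suc zero) (suc (suc zero)))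
                    (λ eq → contradiction (Injection.injective (↔⇒↣ (_≅_.bijection i)) eq) λ ())
  ...   | inj₁ (() , _)
  ...   | inj₂ (_ , ())

ιcValue-≤ : ∀ n k → ιcValue n k → k ≤ n
ιcValue-≤ n k (G , _ , _ , refl) with ιc-isLeast G
... | (D , _ , eq) , _ = subst (_≤ n) eq (∣p∣≤n D)

abstract
  ιcMax-exists : ∀ n → .{{NonZero n}} → ∃ (IsGreatest (ιcValue n))
  ιcMax-exists (suc n) =
    greatest (ιcValue? (suc n)) (suc n) (ιcValue-≤ (suc n))
      (_ , star n , star-connected n , star≇K₃ n , refl)

ιcMax : ∀ n → .{{NonZero n}} → ℕ
ιcMax n = proj₁ (ιcMax-exists n)

ιcMax-isGreatest : ∀ n → .{{_ : NonZero n}} → IsGreatest (ιcValue n) (ιcMax n)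
ιcMax-isGreatest n = proj₂ (ιcMax-exists n)

ιcRatio : ∀ n → .{{NonZero n}} → ℚ
ιcRatio n = + ιcMax n / n

------------------------------------------------------------------------
-- The limit superior inf_N sup_{n ≥ N} a n as a rational number L, unfolded
-- so that no suprema have to exist in ℚ: for every ε > 0 the terms are
-- eventually below L + ε, and infinitely many of them exceed L - ε.

LimSup : (∀ n → .{{NonZero n}} → ℚ) → ℚ → Set
LimSup a L = ∀ ε → 0ℚ <ℚ ε →
  (∃ λ N → ∀ n → .{{_ : NonZero n}} → N ≤ n → a n <ℚ L +ℚ ε) ×
  (∀ N → ∃ λ n → Σ (NonZero n) λ n≢0 → N ≤ n × L -ℚ ε <ℚ a n {{n≢0}})

{-# OPTIONS --safe #-}

-- Upper bound: if G[S] has no component that is a triangle, then some D with 4|D| ≤ |S|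
-- isolates its cycles, by induction on |S|. Choose Y ⊆ S and D with 4|D| ≤ |Y| such that the
-- cycles of S ∖ N[D] avoid Y, apply the induction hypothesis to S ∖ Y without its triangle
-- components and add D. This works unless some triangle component of S ∖ Y avoids N[D], and
-- such a survivor, which has a neighbour in Y, tells how to choose the next pair. If v has
-- neighbours a, p, q and xyz survives D = {v}, Y = {v, a, p, q}, with x ~ a say, try D = {x},
-- Y = {x, y, z, a}. A survivor without v hangs on a, as xyz does, and D = {v, a} disposes of
-- both triangles; a survivor with v is vpq, and then either xyz hangs on a alone, so that
-- D = {a} works, or one of three vertices does. If all degrees are at most two, there are no
-- survivors for Y = {leaf}, D = ∅ and for four consecutive vertices of a cycle.
--
-- Lower bound: m copies of K₄ with one vertex of each joined in a clique need m vertices.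
module Submission where

open import Defs
open import Data.Fin.Base using (Fin; zero; suc; inject₁; fromℕ; toℕ; combine; remQuot)
open import Data.Fin.Permutation using (↔⇒≡)
open import Data.Fin.Properties
  using (any?; all?; suc-injective; toℕ-inject₁; remQuot-combine; combine-remQuot;
         combine-injectiveˡ; combine-injectiveʳ)
  renaming (_≟_ to _≟ᶠ_)
open import Data.Fin.Relation.Unary.Top using (view; ‵fromℕ; ‵inject₁)
open import Data.Fin.Subset using (Subset; _∈_; _⊆_; ∣_∣; ⊤; ⊥; inside; outside)
open import Data.Fin.Subset.Properties
  using (_∈?_; p⊆q⇒∣p∣≤∣q∣; ∣⊥∣≡0; ∉⊥; ∈⊤; ∣⊤∣≡n; x∈p⇒∣p-x∣<∣p∣; x∈p∧x≢y⇒x∈p-y)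
open import Data.Integer.Base as ℤ using (+_)
open import Data.Integer.Properties using (pos-*)
open import Data.Irrelevant using ([_])
open import Data.List.Base using (List; []; _∷_; _++_; length; foldr) renaming (tabulate to tabulateˡ)
open import Data.List.Membership.Propositional using (find) renaming (_∈_ to _∈ˡ_)
import Data.List.Membership.DecPropositional as DecMembership
open import Data.List.Properties using (length-++; length-tabulate)
open import Data.List.Relation.Binary.Permutation.Propositional using (_↭_; prep; swap; ↭-refl; ↭-trans)
open import Data.List.Relation.Binary.Permutation.Propositional.Properties using (All-resp-↭; ∈-resp-↭)
open import Data.List.Relation.Unary.All as All using (All; []; _∷_)
open import Data.List.Relation.Unary.All.Properties using () renaming (tabulate⁺ to All-tabulate⁺)
open import Data.List.Relation.Unary.AllPairs using ([]; _∷_)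
open import Data.List.Relation.Unary.Any as Any using (Any; here; there)
open import Data.List.Relation.Unary.Any.Properties using (++⁺ˡ; ++⁺ʳ)
open import Data.List.Relation.Unary.Unique.Propositional using (Unique)
open import Data.List.Relation.Unary.Unique.Propositional.Properties
  using () renaming (tabulate⁺ to Unique-tabulate⁺)
open import Data.Nat.Base using (ℕ; zero; suc; _+_; _*_; _≤_; _<_; z≤n; s≤s; NonZero)
open import Data.Nat.Induction using (Acc; acc; <-wellFounded)
open import Data.Nat.Properties hiding (suc-injective; _≟_)
open import Data.Product.Base using (∃; ∃₂; _×_; _,_; proj₁; proj₂)
open import Data.Rational.Base as ℚ using (0ℚ; _/_) renaming (_≤_ to _≤ℚ_; _<_ to _<ℚ_)
import Data.Rational.Properties as ℚ
open import Data.Rational.Unnormalised.Base using (mkℚᵘ; *≤*)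
import Data.Rational.Unnormalised.Properties as ℚᵘ
open import Data.Refinement.Base using (Refinement; value) renaming (_,_ to _,ᵣ_)
open import Data.Sum.Base using (_⊎_; inj₁; inj₂)
open import Data.Vec.Base using (tabulate; []; _∷_; _[_]≔_)
open import Data.Vec.Properties using (lookup∘tabulate; []≔-updates; []≔-minimal; []=⇒lookup; lookup⇒[]=)
open import Function.Base using (_∘_; id)
open import Level using (0ℓ)
open import Relation.Binary.Construct.Closure.ReflexiveTransitive using (Star; ε; _◅_; _◅◅_; reverse)
open import Relation.Binary.Definitions using (Symmetric)
open import Relation.Binary.PropositionalEquality
  using (_≡_; _≢_; refl; sym; trans; cong; subst; subst₂; ≢-sym)
open import Relation.Nullary.Decidable
  using (Dec; yes; no; ¬?; does; dec-true; _×-dec_; _⊎-dec_; _→-dec_; decidable-stable; recompute)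
open import Relation.Nullary.Negation using (¬_; contradiction)
open import Relation.Unary using (Pred; Decidable)

private variable
  n : ℕ

pattern #0 = here refl
pattern #1 = there #0
pattern #2 = there #1
pattern #3 = there #2
pattern #4 = there #3
pattern #5 = there #4
pattern #6 = there #5
pattern #7 = there #6

-- Finite subsets and their sizes.

comprehension : {P : Pred (Fin n) 0ℓ} → Decidable P → Subset n
comprehension P? = tabulate (does ∘ P?)

module _ {P : Pred (Fin n) 0ℓ} (P? : Decidable P) where

  ∈-comprehension⁺ : ∀ {u} → P u → u ∈ comprehension P?
  ∈-comprehension⁺ {u} p =
    lookup⇒[]= u _ (trans (lookup∘tabulate _ u) (dec-true (P? u) p))

  ∈-comprehension⁻ : ∀ {u} → u ∈ comprehension P? → P u
  ∈-comprehension⁻ {u} u∈ with P? u | trans (sym (lookup∘tabulate (does ∘ P?) u)) ([]=⇒lookup u∈)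
  ... | yes p | _ = p
  ... | no  _ | ()

-- Induction on `us`: deleting its head from `p` lowers the size, while uniqueness and avoidance
-- keep the rest of `us` and `q` inside what is left.
⊆∧unique∧avoids⇒∣∣≤ : ∀ {p q : Subset n} {us} → q ⊆ p → Unique us → All (_∈ p) us →
                      (∀ {u} → u ∈ q → All (u ≢_) us) → length us + ∣ q ∣ ≤ ∣ p ∣
⊆∧unique∧avoids⇒∣∣≤ q⊆p [] [] _ = p⊆q⇒∣p∣≤∣q∣ q⊆p
⊆∧unique∧avoids⇒∣∣≤ q⊆p (x≢us ∷ !us) (x∈p ∷ us∈p) avoid =
  <-≤-trans (s≤s (⊆∧unique∧avoids⇒∣∣≤
    (λ u∈q → x∈p∧x≢y⇒x∈p-y (q⊆p u∈q) (All.head (avoid u∈q))) !us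
    (All.zipWith (λ (x≢u , u∈p) → x∈p∧x≢y⇒x∈p-y u∈p (≢-sym x≢u)) (x≢us , us∈p))
    (All.tail ∘ avoid)))
    (x∈p⇒∣p-x∣<∣p∣ x∈p)

unique∧⊆⇒length≤ : ∀ {p : Subset n} {us} → Unique us → All (_∈ p) us → length us ≤ ∣ p ∣
unique∧⊆⇒length≤ {n} {p} {us} !us us⊆p = ≤-trans (m≤m+n (length us) ∣ ⊥ {n} ∣)
  (⊆∧unique∧avoids⇒∣∣≤ {q = ⊥} (λ u∈⊥ → contradiction u∈⊥ ∉⊥) !us us⊆p (λ u∈⊥ → contradiction u∈⊥ ∉⊥))

∣insert∣≤ : ∀ (p : Subset n) x → ∣ p [ x ]≔ inside ∣ ≤ suc ∣ p ∣
∣insert∣≤ (inside  ∷ p) zero    = n≤1+n _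
∣insert∣≤ (outside ∷ p) zero    = ≤-refl
∣insert∣≤ (inside  ∷ p) (suc x) = s≤s (∣insert∣≤ p x)
∣insert∣≤ (outside ∷ p) (suc x) = ∣insert∣≤ p x

fromList : List (Fin n) → Subset n
fromList = foldr (λ x p → p [ x ]≔ inside) ⊥

∣fromList∣≤length : ∀ (us : List (Fin n)) → ∣ fromList us ∣ ≤ length us
∣fromList∣≤length {n} []       = ≤-reflexive (∣⊥∣≡0 n)
∣fromList∣≤length     (x ∷ us) = ≤-trans (∣insert∣≤ (fromList us) x) (s≤s (∣fromList∣≤length us))

∈-fromList : ∀ {us : List (Fin n)} {u} → u ∈ˡ us → u ∈ fromList us
∈-fromList {us = x ∷ us} (here refl) = []≔-updates (fromList us) x
∈-fromList {us = x ∷ us} {u} (there u∈us) with u ≟ᶠ x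
... | yes refl = []≔-updates (fromList us) x
... | no  u≢x  = []≔-minimal (fromList us) u x u≢x (∈-fromList u∈us)

-- The first and the last index take one neighbour from `close` and one from `step`, all others take
-- both from `step`; `2 ≤ k` keeps the two apart.
cyclicNeighbours : ∀ {k} {R : Fin (suc k) → Fin (suc k) → Set} → Symmetric R → 2 ≤ k →
                   (∀ j → R (inject₁ j) (suc j)) → R (fromℕ k) zero →
                   ∀ i → ∃₂ λ a b → R i a × R i b × a ≢ b
cyclicNeighbours R-sym (s≤s (s≤s _)) step close zero = _ , _ , step zero , R-sym close , λ ()
cyclicNeighbours R-sym (s≤s (s≤s _)) step close (suc j) with view j
... | ‵fromℕ     = zero , _ , close , R-sym (step j) , λ ()
... | ‵inject₁ j′ = _ , _ , step (suc j′) , R-sym (step j) , λ eq →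
  m≢1+n+m (toℕ j′) {1} (sym (trans (cong toℕ eq) (trans (toℕ-inject₁ _) (toℕ-inject₁ j′))))

-- Domination and triangle components.

module _ (G : Graph (Fin n)) where
  open Graph G

  open DecMembership (_≟ᶠ_ {n}) using () renaming (_∈?_ to _∈ˡ?_)

  ~⇒≢ : ∀ {u v} → u ~ v → u ≢ v
  ~⇒≢ u~v u≡v = ~-irrefl u≡v u~v

  MinDegree2 : Pred (Fin n) 0ℓ → Set
  MinDegree2 C = ∀ {u} → C u → ∃₂ λ a b → C a × C b × u ~ a × u ~ b × a ≢ b

  -- `D` is a list so that case analysis on domination is pattern matching; `fromList` turns it into
  -- a subset at the end.
  Dominated : List (Fin n) → Pred (Fin n) 0ℓ
  Dominated D u = Any (λ d → N[ G ] d u) D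

  dominated? : ∀ D → Decidable (Dominated D)
  dominated? D u = Any.any? (λ d → (u ≟ᶠ d) ⊎-dec (d ~? u)) D

  Undominated : Subset n → List (Fin n) → Pred (Fin n) 0ℓ → Set
  Undominated S D C = ∀ {u} → C u → u ∈ S × ¬ Dominated D u

  -- The vertex set of a cycle is a C of minimum degree two. For arbitrary such C it is
  -- immediate that a vertex with at most one neighbour in the remainder may be ignored.
  Isolates : List (Fin n) → Subset n → Set₁
  Isolates D S = ∀ {C} → MinDegree2 C → Undominated S D C → ∀ {u} → ¬ C u

  QuarterIsolable : Subset n → Set₁
  QuarterIsolable S = ∃ λ D → 4 * length D ≤ ∣ S ∣ × Isolates D S

  Nbhd⊆ : Subset n → Fin n → List (Fin n) → Set
  Nbhd⊆ S u L = ∀ w → w ∈ S → u ~ w → w ∈ˡ L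

  -- With Corner, TriangleComponent S Y a b c says that abc is a component of S ∖ Y.
  Corner : Subset n → List (Fin n) → (a b c : Fin n) → Set
  Corner S Y a b c = a ∈ S × All (a ≢_) Y × a ~ b × Nbhd⊆ S a (b ∷ c ∷ Y)

  TriangleComponent : Subset n → List (Fin n) → (a b c : Fin n) → Set
  TriangleComponent S Y a b c = Corner S Y a b c × Corner S Y b c a × Corner S Y c a b

  corner? : ∀ S Y a b c → Dec (Corner S Y a b c)
  corner? S Y a b c =
    (a ∈? S) ×-dec All.all? (λ y → ¬? (a ≟ᶠ y)) Y ×-dec (a ~? b) ×-dec
    (all? λ w → (w ∈? S) →-dec ((a ~? w) →-dec (w ∈ˡ? (b ∷ c ∷ Y))))

  triangleComponent? : ∀ S Y a b c → Dec (TriangleComponent S Y a b c)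
  triangleComponent? S Y a b c = corner? S Y a b c ×-dec corner? S Y b c a ×-dec corner? S Y c a b

  NoTriangleComponent : Subset n → Set
  NoTriangleComponent S = ∀ {a b c} → ¬ TriangleComponent S [] a b c

  -- So `L` is joined to the rest of `S` through `a` alone.
  Closed : Subset n → Fin n → List (Fin n) → Set
  Closed S a L = All (λ u → Nbhd⊆ S u (a ∷ L)) L

  closed-resp-↭ : ∀ {S a L L′} → L ↭ L′ → Closed S a L → Closed S a L′
  closed-resp-↭ σ closed =
    All-resp-↭ σ (All.map (λ nbhd w w∈S u~w → ∈-resp-↭ (prep _ σ) (nbhd w w∈S u~w)) closed)

  -- Reads the exit edge of a survivor backwards: its end `t` is among the known neighbours of `ys`,
  -- which leaves finitely many positions for it.
  entry : ∀ {S t ys L} → All (λ u → Nbhd⊆ S u L) ys → t ∈ S → Any (t ~_) ys → t ∈ˡ L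
  entry (nbhd ∷ _)  t∈S (here t~y)  = nbhd _ t∈S (~-sym t~y)
  entry (_ ∷ nbhds) t∈S (there t~y) = entry nbhds t∈S t~y

  rotate : ∀ {S Y a b c} → TriangleComponent S Y a b c → TriangleComponent S Y b c a
  rotate (A , B , C) = B , C , A

  rotate-Any : ∀ {P : Pred (Fin n) 0ℓ} {a b c} → Any P (a ∷ b ∷ c ∷ []) → Any P (b ∷ c ∷ a ∷ [])
  rotate-Any (here p)                 = there (there (here p))
  rotate-Any (there (here p))         = here p
  rotate-Any (there (there (here p))) = there (here p)

  -- The corners play symmetric roles, so facts about an arbitrary vertex of a triangle need only be
  -- proved for the first.
  startAt : ∀ {S Y a b c u} → TriangleComponent S Y a b c → u ∈ˡ a ∷ b ∷ c ∷ [] →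
            ∃₂ λ x y → TriangleComponent S Y u x y ×
              (∀ {w} → w ∈ˡ a ∷ b ∷ c ∷ [] → w ∈ˡ u ∷ x ∷ y ∷ []) ×
              (∀ {w} → w ∈ˡ u ∷ x ∷ y ∷ [] → w ∈ˡ a ∷ b ∷ c ∷ [])
  startAt t (here refl)                 = _ , _ , t , id , id
  startAt t (there (here refl))         = _ , _ , rotate t , rotate-Any , rotate-Any ∘ rotate-Any
  startAt t (there (there (here refl))) = _ , _ , rotate (rotate t) , rotate-Any ∘ rotate-Any , rotate-Any

  -- Reductions.

  -- Each vertex of `D` is paid for by four vertices of `Y`. When `D` is empty, `size` says nothing,
  -- and `nonempty` is what makes the induction descend.
  record Reduction (S : Subset n) (Y D : List (Fin n)) : Set₁ where
    field
      Y⊆S    : All (_∈ S) Y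
      unique : Unique Y
      size   : 4 * length D ≤ length Y
      nonempty : 1 ≤ length Y
      avoids : ∀ {C} → MinDegree2 C → Undominated S D C → All (λ y → ¬ C y) Y

  module _ {S Y D} (r : Reduction S Y D)
           (dominates : ∀ {a b c} → TriangleComponent S Y a b c → Any (Dominated D) (a ∷ b ∷ c ∷ []))
           (IH : ∀ {S′} → ∣ S′ ∣ < ∣ S ∣ → NoTriangleComponent S′ → QuarterIsolable S′) where
    open Reduction r

    private
      InTriangle : Pred (Fin n) 0ℓ
      InTriangle u = ∃₂ λ a b → TriangleComponent S Y u a b

      inTriangle? : Decidable InTriangle
      inTriangle? u = any? λ a → any? λ b → triangleComponent? S Y u a b

      rest? : Decidable (λ u → u ∈ S × All (u ≢_) Y × ¬ InTriangle u)
      rest? u = (u ∈? S) ×-dec All.all? (λ y → ¬? (u ≟ᶠ y)) Y ×-dec ¬? (inTriangle? u)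

      -- The induction hypothesis is applied to S ∖ Y without its triangle components.
      S′ : Subset n
      S′ = comprehension rest?

      -- A neighbour of u that lies in a removed triangle would put u in that triangle.
      corner : ∀ {a b c} → Corner S′ [] a b c → Corner S Y a b c
      corner {a} {b} {c} (a∈S′ , _ , a~b , nbhd) with ∈-comprehension⁻ rest? a∈S′
      ... | a∈S , a∉Y , ¬tri = a∈S , a∉Y , a~b , nbhd′
        where
        nbhd′ : Nbhd⊆ S a (b ∷ c ∷ Y)
        nbhd′ w w∈S a~w with All.all? (λ y → ¬? (w ≟ᶠ y)) Y | inTriangle? w
        ... | no ¬w∉Y | _ = there (there (decidable-stable (w ∈ˡ? Y) λ w∉Y →
                ¬w∉Y (All.tabulate λ y∈Y w≡y → w∉Y (subst (_∈ˡ Y) (sym w≡y) y∈Y))))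
        ... | yes w∉Y | no ¬t = ++⁺ˡ {xs = b ∷ c ∷ []} (nbhd w (∈-comprehension⁺ rest? (w∈S , w∉Y , ¬t)) a~w)
        ... | yes _ | yes (x , y , t@((_ , _ , _ , nbhd-w) , _)) with nbhd-w a a∈S (~-sym a~w)
        ...   | here refl = contradiction (_ , _ , rotate t) ¬tri
        ...   | there (here refl) = contradiction (_ , _ , rotate (rotate t)) ¬tri
        ...   | there (there a∈Y) = contradiction refl (All.lookup a∉Y a∈Y)

      -- By `corner`, a triangle component of `S′` would be one of `S ∖ Y`, and the vertices of
      -- those were removed.
      S′-none : NoTriangleComponent S′
      S′-none (A , B , C) with ∈-comprehension⁻ rest? (proj₁ A)
      ... | _ , _ , ¬tri = ¬tri (_ , _ , corner A , corner B , corner C)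

      S′-size : length Y + ∣ S′ ∣ ≤ ∣ S ∣
      S′-size = ⊆∧unique∧avoids⇒∣∣≤ (proj₁ ∘ ∈-comprehension⁻ rest?) unique Y⊆S
                (proj₁ ∘ proj₂ ∘ ∈-comprehension⁻ rest?)

      module _ {C} (md : MinDegree2 C) (und : Undominated S D C) where

        C∉Y : ∀ {u} → C u → All (u ≢_) Y
        C∉Y Cu = All.map (λ ¬Cy u≡y → ¬Cy (subst C u≡y Cu)) (avoids md und)

        -- A triangle component that D dominates partially keeps at most two vertices.
        C∉triangle : ∀ {u} → C u → ¬ InTriangle u
        C∉triangle Cu (a , b , t@((_ , _ , _ , nbhd) , _)) with dominates t
        ... | here dom = proj₂ (und Cu) dom
        ... | there dom with md Cu
        ...   | x , y , Cx , Cy , u~x , u~y , x≢y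
              with nbhd x (proj₁ (und Cx)) u~x | nbhd y (proj₁ (und Cy)) u~y | dom
        ...     | there (there x∈Y) | _ | _ = All.lookup (C∉Y Cx) x∈Y refl
        ...     | _ | there (there y∈Y) | _ = All.lookup (C∉Y Cy) y∈Y refl
        ...     | here refl | here refl | _ = x≢y refl
        ...     | there (here refl) | there (here refl) | _ = x≢y refl
        ...     | here refl | _ | here d = proj₂ (und Cx) d
        ...     | _ | here refl | here d = proj₂ (und Cy) d
        ...     | there (here refl) | _ | there (here d) = proj₂ (und Cx) d
        ...     | _ | there (here refl) | there (here d) = proj₂ (und Cy) d

        C⊆S′ : ∀ {u} → C u → u ∈ S′
        C⊆S′ Cu = ∈-comprehension⁺ rest? (proj₁ (und Cu) , C∉Y Cu , C∉triangle Cu)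

    -- The removed triangles need no payment: each meets `N[D]` by `dominates`, so a `C` that `D`
    -- leaves undominated lies wholly in `S′`, where `iso′` refutes it.
    reduce : QuarterIsolable S
    reduce with IH (≤-trans (+-monoˡ-≤ _ nonempty) S′-size) S′-none
    ... | D′ , size′ , iso′ = D ++ D′ , bound , λ md und →
      let und₁ = λ {u} Cu → proj₁ (und {u} Cu) , λ d → proj₂ (und Cu) (++⁺ˡ d) in
      iso′ md λ Cu → C⊆S′ md und₁ Cu , λ d → proj₂ (und Cu) (++⁺ʳ D d)
      where
      open ≤-Reasoning
      bound : 4 * length (D ++ D′) ≤ ∣ S ∣
      bound = begin
        4 * length (D ++ D′)          ≡⟨ cong (4 *_) (length-++ D) ⟩
        4 * (length D + length D′)    ≡⟨ *-distribˡ-+ 4 (length D) (length D′) ⟩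
        4 * length D + 4 * length D′  ≤⟨ +-mono-≤ size size′ ⟩
        length Y + ∣ S′ ∣             ≤⟨ S′-size ⟩
        ∣ S ∣                         ∎

  -- Triangles that survive a reduction.

  -- A component of S ∖ Y that is a triangle avoiding N[D]. Since S has no triangle
  -- component, one of its vertices (the first, by choice) has a neighbour in Y.
  record Survivor (S : Subset n) (Y D : List (Fin n)) : Set where
    field
      {t₁ t₂ t₃}  : Fin n
      triangle    : TriangleComponent S Y t₁ t₂ t₃
      undominated : ¬ Any (Dominated D) (t₁ ∷ t₂ ∷ t₃ ∷ [])
      exit        : Any (t₁ ~_) Y

    T : Pred (Fin n) 0ℓ
    T u = u ∈ˡ t₁ ∷ t₂ ∷ t₃ ∷ []

    T? : Decidable T
    T? u = u ∈ˡ? (t₁ ∷ t₂ ∷ t₃ ∷ [])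

    private variable
      u p q w : Fin n

    T⊆S : T u → u ∈ S
    T⊆S Tu with startAt triangle Tu
    ... | _ , _ , ((u∈S , _) , _) , _ = u∈S

    T∉Y : T u → All (u ≢_) Y
    T∉Y Tu with startAt triangle Tu
    ... | _ , _ , ((_ , u∉Y , _) , _) , _ = u∉Y

    T∩Y : T u → ¬ u ∈ˡ Y
    T∩Y Tu u∈Y = All.lookup (T∉Y Tu) u∈Y refl

    ¬dominated : T u → ¬ Dominated D u
    ¬dominated Tu dom = undominated (Any.map (λ { refl → dom }) Tu)

    neighbour : T u → w ∈ S → u ~ w → T w ⊎ w ∈ˡ Y
    neighbour Tu w∈S u~w with startAt triangle Tu
    ... | _ , _ , ((_ , _ , _ , nbhd) , _) , _ , back with nbhd _ w∈S u~w
    ...   | here refl         = inj₁ (back (there (here refl)))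
    ...   | there (here refl) = inj₁ (back (there (there (here refl))))
    ...   | there (there w∈Y) = inj₂ w∈Y

    -- An edge of `S` that leaves a component of `S ∖ Y` ends in `Y`. With this, one known vertex of
    -- a survivor yields the others.
    spread : T u → w ∈ S → u ~ w → All (w ≢_) Y → T w
    spread Tu w∈S u~w w∉Y with neighbour Tu w∈S u~w
    ... | inj₁ Tw  = Tw
    ... | inj₂ w∈Y = contradiction refl (All.lookup w∉Y w∈Y)

    adjacent : T u → T w → u ≢ w → u ~ w
    adjacent Tu Tw u≢w with startAt triangle Tu
    ... | _ , _ , ((_ , _ , u~x , _) , _ , (_ , _ , y~u , _)) , same , _ with same Tw
    ...   | here refl                 = contradiction refl u≢w
    ...   | there (here refl)         = u~x
    ...   | there (there (here refl)) = ~-sym y~u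

    others : T u → ∃₂ λ x y → T x × T y × u ~ x × u ~ y × x ~ y
    others Tu with startAt triangle Tu
    ... | x , y , ((_ , _ , u~x , _) , (_ , _ , x~y , _) , (_ , _ , y~u , _)) , _ , back =
      x , y , back (there (here refl)) , back (there (there (here refl))) , u~x , ~-sym y~u , x~y

    three : T u → T p → T q → u ≢ p → u ≢ q → p ≢ q → T w → w ∈ˡ u ∷ p ∷ q ∷ []
    three Tu Tp Tq u≢p u≢q p≢q Tw with startAt triangle Tu
    ... | _ , _ , _ , same , _ with same Tp | same Tq | same Tw
    ...   | here refl | _ | _ = contradiction refl u≢p
    ...   | _ | here refl | _ = contradiction refl u≢q
    ...   | _ | _ | here refl = here refl
    ...   | there (here refl) | there (here refl) | _ = contradiction refl p≢q
    ...   | there (there (here refl)) | there (there (here refl)) | _ = contradiction refl p≢q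
    ...   | there (here refl) | _ | there (here refl) = there (here refl)
    ...   | _ | there (here refl) | there (here refl) = there (there (here refl))
    ...   | there (there (here refl)) | _ | there (there (here refl)) = there (here refl)
    ...   | _ | there (there (here refl)) | there (there (here refl)) = there (there (here refl))

  -- The induction step.

  module Step {S : Subset n} (none : NoTriangleComponent S)
              (IH : ∀ {S′} → ∣ S′ ∣ < ∣ S ∣ → NoTriangleComponent S′ → QuarterIsolable S′) where

    private
      isolated : ∀ {a b c Y} → Corner S Y a b c → ¬ Any (a ~_) Y → Corner S [] a b c
      isolated (a∈S , _ , a~b , nbhd) a≁Y = a∈S , [] , a~b , λ w w∈S a~w → restrict a~w (nbhd w w∈S a~w)
        where
        restrict : ∀ {w b c} → _ ~ w → w ∈ˡ b ∷ c ∷ _ → w ∈ˡ b ∷ c ∷ []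
        restrict a~w (here eq)           = here eq
        restrict a~w (there (here eq))   = there (here eq)
        restrict a~w (there (there w∈Y)) = contradiction (Any.map (λ { refl → a~w }) w∈Y) a≁Y

    -- If no vertex of the triangle had a neighbour in `Y`, the triangle would be a component of `S`
    -- itself, contrary to `none`.
    survivor : ∀ {Y D a b c} → TriangleComponent S Y a b c → ¬ Any (Dominated D) (a ∷ b ∷ c ∷ []) →
               Survivor S Y D
    survivor {Y} {a = a} {b} {c} t@(A , B , C) und
      with Any.any? (a ~?_) Y | Any.any? (b ~?_) Y | Any.any? (c ~?_) Y
    ... | yes exit | _ | _ = record { triangle = t ; undominated = und ; exit = exit }
    ... | _ | yes exit | _ = record
      { triangle = rotate t ; undominated = und ∘ rotate-Any ∘ rotate-Any ; exit = exit }
    ... | _ | _ | yes exit = record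
      { triangle = rotate (rotate t) ; undominated = und ∘ rotate-Any ; exit = exit }
    ... | no a≁ | no b≁ | no c≁ = contradiction (isolated A a≁ , isolated B b≁ , isolated C c≁) none

    -- Without a survivor `reduce` finishes; otherwise the survivor is handed on as structural
    -- information. Nested attempts collect survivors until they contradict each other.
    attempt : ∀ {Y D} → Reduction S Y D → (Survivor S Y D → QuarterIsolable S) → QuarterIsolable S
    attempt {Y} {D} r k with any? (λ a → any? λ b → any? λ c →
        triangleComponent? S Y a b c ×-dec ¬? (Any.any? (dominated? D) (a ∷ b ∷ c ∷ [])))
    ... | yes (_ , _ , _ , t , und) = k (survivor t und)
    ... | no ¬t = reduce r (λ t →
      decidable-stable (Any.any? (dominated? D) _) λ und → ¬t (_ , _ , _ , t , und)) IH

    -- A vertex dominates itself and its neighbours, so no undominated set meets `Y`; three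
    -- neighbours suffice to pay for it.
    star : ∀ {d ys} → d ∈ S → All (_∈ S) ys → Unique (d ∷ ys) → 4 ≤ suc (length ys) → All (d ~_) ys →
           Reduction S (d ∷ ys) (d ∷ [])
    star d∈S ys∈S !Y 4≤ d~ys = record
      { Y⊆S      = d∈S ∷ ys∈S
      ; unique   = !Y
      ; size     = 4≤
      ; nonempty = s≤s z≤n
      ; avoids   = λ _ und → (λ Cd → proj₂ (und Cd) (here (inj₁ refl))) ∷
                             All.map (λ d~y Cy → proj₂ (und Cy) (here (inj₂ d~y))) d~ys
      }

    -- Vertices of degree at least three.

    -- Triangles vpq and xyz joined by the edge py and the path v – a – x; only a may have
    -- further neighbours. One of p, y, a dominates enough.
    module Seven
      {a v p q x y z : Fin n}
      (a∈S : a ∈ S) (v∈S : v ∈ S) (p∈S : p ∈ S) (q∈S : q ∈ S) (x∈S : x ∈ S) (y∈S : y ∈ S) (z∈S : z ∈ S)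
      (a~v : a ~ v) (v~p : v ~ p) (v~q : v ~ q) (p~q : p ~ q)
      (a~x : a ~ x) (x~y : x ~ y) (x~z : x ~ z) (y~z : y ~ z)
      (a≢p : a ≢ p) (a≢q : a ≢ q) (a≢y : a ≢ y) (a≢z : a ≢ z)
      (v≢x : v ≢ x) (v≢y : v ≢ y) (v≢z : v ≢ z)
      (p≢x : p ≢ x) (p≢y : p ≢ y) (p≢z : p ≢ z)
      (q≢x : q ≢ x) (q≢y : q ≢ y) (q≢z : q ≢ z)
      where

      L : List (Fin n)
      L = v ∷ p ∷ q ∷ x ∷ y ∷ z ∷ []

      module _ (closed : Closed S a L) (p~y : p ~ y) where

        -- By closedness the vertex with the exit edge is in `a ∷ L`, and of that list only `a`, `x`
        -- and `z` avoid `Y`. The edges at `x` then put `a` and `z` into the survivor.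
        a~z-of : Survivor S (p ∷ v ∷ q ∷ y ∷ []) (p ∷ []) → a ~ z
        a~z-of s = adjacent (proj₁ ends) (proj₂ ends) a≢z
          where
          open Survivor s using (T; T⊆S; T∩Y; ¬dominated; spread; adjacent; exit)
          a∉ : All (a ≢_) (p ∷ v ∷ q ∷ y ∷ [])
          a∉ = a≢p ∷ ~⇒≢ a~v ∷ a≢q ∷ a≢y ∷ []
          x∉ : All (x ≢_) (p ∷ v ∷ q ∷ y ∷ [])
          x∉ = ≢-sym p≢x ∷ ≢-sym v≢x ∷ ≢-sym q≢x ∷ ~⇒≢ x~y ∷ []
          z∉ : All (z ≢_) (p ∷ v ∷ q ∷ y ∷ [])
          z∉ = ≢-sym p≢z ∷ ≢-sym v≢z ∷ ≢-sym q≢z ∷ ≢-sym (~⇒≢ y~z) ∷ []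
          fromX : T x → T a × T z
          fromX Tx = spread Tx a∈S (~-sym a~x) a∉ , spread Tx z∈S x~z z∉
          T₀ : T (Survivor.t₁ s)
          T₀ = here refl
          ends : T a × T z
          ends with exit
          ... | here t~p = contradiction (here (inj₂ (~-sym t~p))) (¬dominated T₀)
          ... | there t~ with entry (All.map (All.lookup closed) (#0 ∷ #2 ∷ #4 ∷ [])) (T⊆S T₀) t~
          ...   | #0 = fromX (spread T₀ x∈S a~x x∉)
          ...   | #1 = contradiction #1 (T∩Y T₀)
          ...   | #2 = contradiction #0 (T∩Y T₀)
          ...   | #3 = contradiction #2 (T∩Y T₀)
          ...   | #4 = fromX T₀
          ...   | #5 = contradiction #3 (T∩Y T₀)
          ...   | #6 = fromX (spread T₀ x∈S (~-sym x~z) x∉)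

        -- This is `a~z-of` with the roles of `v`, `p`, `q` and `x`, `y`, `z` exchanged.
        a~q-of : Survivor S (y ∷ x ∷ z ∷ p ∷ []) (y ∷ []) → a ~ q
        a~q-of s = adjacent (proj₁ ends) (proj₂ ends) a≢q
          where
          open Survivor s using (T; T⊆S; T∩Y; ¬dominated; spread; adjacent; exit)
          a∉ : All (a ≢_) (y ∷ x ∷ z ∷ p ∷ [])
          a∉ = a≢y ∷ ~⇒≢ a~x ∷ a≢z ∷ a≢p ∷ []
          v∉ : All (v ≢_) (y ∷ x ∷ z ∷ p ∷ [])
          v∉ = v≢y ∷ v≢x ∷ v≢z ∷ ~⇒≢ v~p ∷ []
          q∉ : All (q ≢_) (y ∷ x ∷ z ∷ p ∷ [])
          q∉ = q≢y ∷ q≢x ∷ q≢z ∷ ≢-sym (~⇒≢ p~q) ∷ []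
          fromV : T v → T a × T q
          fromV Tv = spread Tv a∈S (~-sym a~v) a∉ , spread Tv q∈S v~q q∉
          T₀ : T (Survivor.t₁ s)
          T₀ = here refl
          ends : T a × T q
          ends with exit
          ... | here t~y = contradiction (here (inj₂ (~-sym t~y))) (¬dominated T₀)
          ... | there t~ with entry (All.map (All.lookup closed) (#3 ∷ #5 ∷ #1 ∷ [])) (T⊆S T₀) t~
          ...   | #0 = fromV (spread T₀ v∈S a~v v∉)
          ...   | #1 = fromV T₀
          ...   | #2 = contradiction #3 (T∩Y T₀)
          ...   | #3 = fromV (spread T₀ v∈S (~-sym v~q) v∉)
          ...   | #4 = contradiction #1 (T∩Y T₀)
          ...   | #5 = contradiction #0 (T∩Y T₀)
          ...   | #6 = contradiction #2 (T∩Y T₀)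

        -- Of `a ∷ L` only `p`, `y` and `z` avoid `Y`. The path from `p` over `y` to `z` brings `z`
        -- into the survivor, but `a` dominates `z`.
        no-survivor : a ~ z → ¬ Survivor S (a ∷ v ∷ x ∷ q ∷ []) (a ∷ [])
        no-survivor a~z s = ¬dominated Tz (here (inj₂ a~z))
          where
          open Survivor s using (T; T⊆S; T∩Y; ¬dominated; spread; exit)
          y∉ : All (y ≢_) (a ∷ v ∷ x ∷ q ∷ [])
          y∉ = ≢-sym a≢y ∷ ≢-sym v≢y ∷ ≢-sym (~⇒≢ x~y) ∷ ≢-sym q≢y ∷ []
          z∉ : All (z ≢_) (a ∷ v ∷ x ∷ q ∷ [])
          z∉ = ≢-sym a≢z ∷ ≢-sym v≢z ∷ ≢-sym (~⇒≢ x~z) ∷ ≢-sym q≢z ∷ []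
          fromY : T y → T z
          fromY Ty = spread Ty z∈S y~z z∉
          T₀ : T (Survivor.t₁ s)
          T₀ = here refl
          Tz : T z
          Tz with exit
          ... | here t~a = contradiction (here (inj₂ (~-sym t~a))) (¬dominated T₀)
          ... | there t~ with entry (All.map (All.lookup closed) (#0 ∷ #3 ∷ #2 ∷ [])) (T⊆S T₀) t~
          ...   | #0 = contradiction #0 (T∩Y T₀)
          ...   | #1 = contradiction #1 (T∩Y T₀)
          ...   | #2 = fromY (spread T₀ y∈S p~y y∉)
          ...   | #3 = contradiction #3 (T∩Y T₀)
          ...   | #4 = contradiction #2 (T∩Y T₀)
          ...   | #5 = fromY T₀
          ...   | #6 = T₀

        -- The first two survivors yield `a ~ z` and `a ~ q`. The edge `a ~ q` makes the third star
        -- available, and `a ~ z` rules out its survivor.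
        isolable : QuarterIsolable S
        isolable =
          attempt (star p∈S (v∈S ∷ q∈S ∷ y∈S ∷ [])
                    ((≢-sym (~⇒≢ v~p) ∷ ~⇒≢ p~q ∷ p≢y ∷ []) ∷
                     (~⇒≢ v~q ∷ v≢y ∷ []) ∷ (q≢y ∷ []) ∷ [] ∷ [])
                    ≤-refl (~-sym v~p ∷ p~q ∷ p~y ∷ [])) λ s₁ →
          attempt (star y∈S (x∈S ∷ z∈S ∷ p∈S ∷ [])
                    ((≢-sym (~⇒≢ x~y) ∷ ~⇒≢ y~z ∷ ≢-sym p≢y ∷ []) ∷
                     (~⇒≢ x~z ∷ ≢-sym p≢x ∷ []) ∷ (≢-sym p≢z ∷ []) ∷ [] ∷ [])
                    ≤-refl (~-sym x~y ∷ y~z ∷ ~-sym p~y ∷ [])) λ s₂ →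
          attempt (star a∈S (v∈S ∷ x∈S ∷ q∈S ∷ [])
                    ((~⇒≢ a~v ∷ ~⇒≢ a~x ∷ a≢q ∷ []) ∷ (v≢x ∷ ~⇒≢ v~q ∷ []) ∷ (≢-sym q≢x ∷ []) ∷ [] ∷ [])
                    ≤-refl (a~v ∷ a~x ∷ a~q-of s₂ ∷ [])) λ s₃ →
          contradiction s₃ (no-survivor (a~z-of s₁))

    atMostOneNeighbour : ∀ {C u z} → MinDegree2 C → (∀ {w} → C w → u ~ w → w ≡ z) → ¬ C u
    atMostOneNeighbour md only Cu with md Cu
    ... | _ , _ , Cx , Cy , u~x , u~y , x≢y = x≢y (trans (only Cx u~x) (sym (only Cy u~y)))

    -- xyz is a triangle component of S ∖ {v, a, p, q} that avoids N[v].
    module Claw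
      {a v p q x y z : Fin n}
      (a∈S : a ∈ S) (v∈S : v ∈ S) (p∈S : p ∈ S) (q∈S : q ∈ S) (x∈S : x ∈ S) (y∈S : y ∈ S) (z∈S : z ∈ S)
      (v~a : v ~ a) (v~p : v ~ p) (v~q : v ~ q) (a≢p : a ≢ p) (a≢q : a ≢ q) (p≢q : p ≢ q)
      (x~a : x ~ a) (x~y : x ~ y) (x~z : x ~ z) (y~z : y ~ z)
      (nbhd : All (λ u → Nbhd⊆ S u (a ∷ p ∷ q ∷ x ∷ y ∷ z ∷ [])) (x ∷ y ∷ z ∷ []))
      (far : ∀ {u} → u ∈ˡ x ∷ y ∷ z ∷ [] → ¬ Dominated (v ∷ []) u)
      where

      v≢ : ∀ {u} → u ∈ˡ x ∷ y ∷ z ∷ [] → v ≢ u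
      v≢ u∈ v≡u = far u∈ (here (inj₁ (sym v≡u)))

      neighbour≢ : ∀ {u w} → v ~ w → u ∈ˡ x ∷ y ∷ z ∷ [] → w ≢ u
      neighbour≢ v~w u∈ refl = far u∈ (here (inj₂ v~w))

      Y : List (Fin n)
      Y = x ∷ y ∷ z ∷ a ∷ []

      module Near (s : Survivor S Y (x ∷ [])) (Tv : Survivor.T s v) where
        open Survivor s

        -- As `xyz` avoids `N[v]`, the neighbours `p` and `q` of `v` lie outside `Y`; so the
        -- survivor is `vpq`.
        Tp : T p
        Tp = spread Tv p∈S v~p (neighbour≢ v~p #0 ∷ neighbour≢ v~p #1 ∷ neighbour≢ v~p #2 ∷ ≢-sym a≢p ∷ [])

        Tq : T q
        Tq = spread Tv q∈S v~q (neighbour≢ v~q #0 ∷ neighbour≢ v~q #1 ∷ neighbour≢ v~q #2 ∷ ≢-sym a≢q ∷ [])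

        L : List (Fin n)
        L = v ∷ p ∷ q ∷ x ∷ y ∷ z ∷ []

        T⊆ : ∀ {w} → T w → w ∈ˡ a ∷ L
        T⊆ Tw with three Tv Tp Tq (~⇒≢ v~p) (~⇒≢ v~q) p≢q Tw
        ... | #0 = #1
        ... | #1 = #2
        ... | #2 = #3

        -- Each triangle supplies its half: `vpq` is a component of `S ∖ Y`, and `nbhd` limits the
        -- neighbours of `xyz`.
        closed : Closed S a L
        closed = outer Tv ∷ outer Tp ∷ outer Tq ∷ All.map inner nbhd
          where
          outer : ∀ {u} → T u → Nbhd⊆ S u (a ∷ L)
          outer Tu w w∈S u~w with neighbour Tu w∈S u~w
          ... | inj₁ Tw = T⊆ Tw
          ... | inj₂ #0 = #4
          ... | inj₂ #1 = #5
          ... | inj₂ #2 = #6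
          ... | inj₂ #3 = #0
          inner : ∀ {u} → Nbhd⊆ S u (a ∷ p ∷ q ∷ x ∷ y ∷ z ∷ []) → Nbhd⊆ S u (a ∷ L)
          inner nb w w∈S u~w with nb w w∈S u~w
          ... | #0 = #0
          ... | there w∈ = there (there w∈)

        undominated-x : ∀ {u} → T u → ¬ x ~ u
        undominated-x Tu x~u = ¬dominated Tu (here (inj₂ x~u))

        isolable : QuarterIsolable S
        -- An edge from `p` or `q` to `y` or `z` gives the configuration of `Seven`, after
        -- exchanging `p` with `q` or `y` with `z` where necessary.
        isolable with p ~? y | q ~? y | p ~? z | q ~? z
        ... | yes p~y | _ | _ | _ = Seven.isolable a∈S v∈S p∈S q∈S x∈S y∈S z∈S
            (~-sym v~a) v~p v~q (adjacent Tp Tq p≢q) (~-sym x~a) x~y x~z y~z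
            a≢p a≢q (neighbour≢ v~a #1) (neighbour≢ v~a #2) (v≢ #0) (v≢ #1) (v≢ #2)
            (neighbour≢ v~p #0) (neighbour≢ v~p #1) (neighbour≢ v~p #2)
            (neighbour≢ v~q #0) (neighbour≢ v~q #1) (neighbour≢ v~q #2)
            closed p~y
        ... | _ | yes q~y | _ | _ = Seven.isolable a∈S v∈S q∈S p∈S x∈S y∈S z∈S
            (~-sym v~a) v~q v~p (adjacent Tq Tp (≢-sym p≢q)) (~-sym x~a) x~y x~z y~z
            a≢q a≢p (neighbour≢ v~a #1) (neighbour≢ v~a #2) (v≢ #0) (v≢ #1) (v≢ #2)
            (neighbour≢ v~q #0) (neighbour≢ v~q #1) (neighbour≢ v~q #2)
            (neighbour≢ v~p #0) (neighbour≢ v~p #1) (neighbour≢ v~p #2)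
            (closed-resp-↭ (prep v (swap p q ↭-refl)) closed) q~y
        ... | _ | _ | yes p~z | _ = Seven.isolable a∈S v∈S p∈S q∈S x∈S z∈S y∈S
            (~-sym v~a) v~p v~q (adjacent Tp Tq p≢q) (~-sym x~a) x~z x~y (~-sym y~z)
            a≢p a≢q (neighbour≢ v~a #2) (neighbour≢ v~a #1) (v≢ #0) (v≢ #2) (v≢ #1)
            (neighbour≢ v~p #0) (neighbour≢ v~p #2) (neighbour≢ v~p #1)
            (neighbour≢ v~q #0) (neighbour≢ v~q #2) (neighbour≢ v~q #1)
            (closed-resp-↭ (prep v (prep p (prep q (prep x (swap y z ↭-refl))))) closed) p~z
        ... | _ | _ | _ | yes q~z = Seven.isolable a∈S v∈S q∈S p∈S x∈S z∈S y∈S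
            (~-sym v~a) v~q v~p (adjacent Tq Tp (≢-sym p≢q)) (~-sym x~a) x~z x~y (~-sym y~z)
            a≢q a≢p (neighbour≢ v~a #2) (neighbour≢ v~a #1) (v≢ #0) (v≢ #2) (v≢ #1)
            (neighbour≢ v~q #0) (neighbour≢ v~q #2) (neighbour≢ v~q #1)
            (neighbour≢ v~p #0) (neighbour≢ v~p #2) (neighbour≢ v~p #1)
            (closed-resp-↭ (prep v (swap p q (prep x (swap y z ↭-refl)))) closed) q~z
        -- As `x` is adjacent to neither `p` nor `q`, no edge joins the two triangles, and `xyz`
        -- hangs on `a` alone.
        ... | no p≁y | no q≁y | no p≁z | no q≁z = attempt pendant λ s′ → contradiction s′ no-survivor
          where
          nbhd′ : All (λ u → Nbhd⊆ S u Y) (x ∷ y ∷ z ∷ [])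
          nbhd′ = restrict (undominated-x Tp) (undominated-x Tq) (All.head nbhd) ∷
                  restrict (p≁y ∘ ~-sym) (q≁y ∘ ~-sym) (All.lookup nbhd #1) ∷
                  restrict (p≁z ∘ ~-sym) (q≁z ∘ ~-sym) (All.lookup nbhd #2) ∷ []
            where
            restrict : ∀ {u} → ¬ u ~ p → ¬ u ~ q → Nbhd⊆ S u (a ∷ p ∷ q ∷ x ∷ y ∷ z ∷ []) → Nbhd⊆ S u Y
            restrict u≁p u≁q nb w w∈S u~w with nb w w∈S u~w
            ... | #0 = #3
            ... | #1 = contradiction u~w u≁p
            ... | #2 = contradiction u~w u≁q
            ... | #3 = #0
            ... | #4 = #1
            ... | #5 = #2

          -- With `a` and `x` dominated, `y` and `z` have only each other left.
          pendant : Reduction S (a ∷ x ∷ y ∷ z ∷ []) (a ∷ [])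
          pendant = record
            { Y⊆S = a∈S ∷ x∈S ∷ y∈S ∷ z∈S ∷ []
            ; unique = (neighbour≢ v~a #0 ∷ neighbour≢ v~a #1 ∷ neighbour≢ v~a #2 ∷ []) ∷
                       (~⇒≢ x~y ∷ ~⇒≢ x~z ∷ []) ∷ (~⇒≢ y~z ∷ []) ∷ [] ∷ []
            ; size = ≤-refl
            ; nonempty = s≤s z≤n
            ; avoids = λ {C} md und →
                let ¬Ca : ¬ C a
                    ¬Ca Ca = proj₂ (und Ca) (here (inj₁ refl))
                    ¬Cx : ¬ C x
                    ¬Cx Cx = proj₂ (und Cx) (here (inj₂ (~-sym x~a)))
                in ¬Ca ∷ ¬Cx ∷
                   atMostOneNeighbour md (λ Cw y~w →
                     onlyZ Cw ¬Ca ¬Cx y~w (All.lookup nbhd′ #1 _ (proj₁ (und Cw)) y~w)) ∷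
                   atMostOneNeighbour md (λ Cw z~w →
                     onlyY Cw ¬Ca ¬Cx z~w (All.lookup nbhd′ #2 _ (proj₁ (und Cw)) z~w)) ∷ []
            }
            where
            onlyZ : ∀ {C : Pred (Fin n) 0ℓ} {w} → C w → ¬ C a → ¬ C x → y ~ w → w ∈ˡ Y → w ≡ z
            onlyZ Cw _ ¬Cx _ #0 = contradiction Cw ¬Cx
            onlyZ _ _ _ y~y #1 = contradiction refl (~⇒≢ y~y)
            onlyZ _ _ _ _ #2 = refl
            onlyZ Cw ¬Ca _ _ #3 = contradiction Cw ¬Ca
            onlyY : ∀ {C : Pred (Fin n) 0ℓ} {w} → C w → ¬ C a → ¬ C x → z ~ w → w ∈ˡ Y → w ≡ y
            onlyY Cw _ ¬Cx _ #0 = contradiction Cw ¬Cx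
            onlyY _ _ _ _ #1 = refl
            onlyY _ _ _ z~z #2 = contradiction refl (~⇒≢ z~z)
            onlyY Cw ¬Ca _ _ #3 = contradiction Cw ¬Ca

          no-survivor : ¬ Survivor S (a ∷ x ∷ y ∷ z ∷ []) (a ∷ [])
          no-survivor s′ with Survivor.exit s′
          ... | here t~a = Survivor.¬dominated s′ (here refl) (here (inj₂ (~-sym t~a)))
          ... | there t~ with entry nbhd′ (Survivor.T⊆S s′ (here refl)) t~
          ...   | #0 = Survivor.T∩Y s′ (here refl) #1
          ...   | #1 = Survivor.T∩Y s′ (here refl) #2
          ...   | #2 = Survivor.T∩Y s′ (here refl) #3
          ...   | #3 = Survivor.T∩Y s′ (here refl) #0

      module Far (s : Survivor S Y (x ∷ [])) (¬Tv : ¬ Survivor.T s v) where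
        open Survivor s

        ¬Tneighbour : ∀ {u} → v ~ u → ¬ T u
        ¬Tneighbour v~u Tu = ¬Tv (spread Tu v∈S (~-sym v~u) (v≢ #0 ∷ v≢ #1 ∷ v≢ #2 ∷ ~⇒≢ v~a ∷ []))

        -- The neighbours of `xyz` are among `a`, `x`, `y`, `z`, which lie in `Y`, and `p`, `q`,
        -- which are adjacent to `v`. Hence the survivor can exit only to `a`.
        separate : ∀ {u w} → T u → w ∈ˡ x ∷ y ∷ z ∷ [] → ¬ u ~ w
        separate Tu w∈ u~w with All.lookup nbhd w∈ _ (T⊆S Tu) (~-sym u~w)
        ... | #0 = T∩Y Tu #3
        ... | #1 = ¬Tneighbour v~p Tu
        ... | #2 = ¬Tneighbour v~q Tu
        ... | #3 = T∩Y Tu #0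
        ... | #4 = T∩Y Tu #1
        ... | #5 = T∩Y Tu #2

        module _ {t k l : Fin n} (Tt : T t) (Tk : T k) (Tl : T l)
                 (t~k : t ~ k) (t~l : t ~ l) (k~l : k ~ l) (t~a : t ~ a) where

          Y′ : List (Fin n)
          Y′ = v ∷ a ∷ t ∷ k ∷ l ∷ x ∷ y ∷ z ∷ []

          T⊆ : ∀ {w} → T w → w ∈ˡ t ∷ k ∷ l ∷ []
          T⊆ = three Tt Tk Tl (~⇒≢ t~k) (~⇒≢ t~l) (~⇒≢ k~l)

          ≢T : ∀ {u w} → T u → w ∈ˡ Y → u ≢ w
          ≢T Tu w∈Y refl = T∩Y Tu w∈Y

          v≢T : ∀ {u} → T u → v ≢ u
          v≢T Tu refl = ¬Tv Tu

          module _ {C : Pred (Fin n) 0ℓ} (md : MinDegree2 C) (und : Undominated S (v ∷ a ∷ []) C) where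

            ¬C-v : ∀ {u} → v ~ u → ¬ C u
            ¬C-v v~u Cu = proj₂ (und Cu) (here (inj₂ v~u))

            ¬C-a : ∀ {u} → a ~ u → ¬ C u
            ¬C-a a~u Cu = proj₂ (und Cu) (there (here (inj₂ a~u)))

            private variable
              w : Fin n

            fromY : C w → y ~ w → w ≡ z
            fromY Cw y~w with All.lookup nbhd #1 _ (proj₁ (und Cw)) y~w
            ... | #0 = contradiction Cw (¬C-v v~a)
            ... | #1 = contradiction Cw (¬C-v v~p)
            ... | #2 = contradiction Cw (¬C-v v~q)
            ... | #3 = contradiction Cw (¬C-a (~-sym x~a))
            ... | #4 = contradiction refl (~⇒≢ y~w)
            ... | #5 = refl

            fromZ : C w → z ~ w → w ≡ y
            fromZ Cw z~w with All.lookup nbhd #2 _ (proj₁ (und Cw)) z~w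
            ... | #0 = contradiction Cw (¬C-v v~a)
            ... | #1 = contradiction Cw (¬C-v v~p)
            ... | #2 = contradiction Cw (¬C-v v~q)
            ... | #3 = contradiction Cw (¬C-a (~-sym x~a))
            ... | #4 = refl
            ... | #5 = contradiction refl (~⇒≢ z~w)

            fromT : ∀ {u} → T u → C w → u ~ w → T w
            fromT Tu Cw u~w with neighbour Tu (proj₁ (und Cw)) u~w
            ... | inj₁ Tw = Tw
            ... | inj₂ #0 = contradiction u~w (separate Tu #0)
            ... | inj₂ #1 = contradiction u~w (separate Tu #1)
            ... | inj₂ #2 = contradiction u~w (separate Tu #2)
            ... | inj₂ #3 = contradiction Cw (¬C-v v~a)

            fromK : C w → k ~ w → w ≡ l
            fromK Cw k~w with T⊆ (fromT Tk Cw k~w)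
            ... | #0 = contradiction Cw (¬C-a (~-sym t~a))
            ... | #1 = contradiction refl (~⇒≢ k~w)
            ... | #2 = refl

            fromL : C w → l ~ w → w ≡ k
            fromL Cw l~w with T⊆ (fromT Tl Cw l~w)
            ... | #0 = contradiction Cw (¬C-a (~-sym t~a))
            ... | #1 = refl
            ... | #2 = contradiction refl (~⇒≢ l~w)

            -- `a` dominates `t` and `x`, and `v` dominates `p` and `q`; so `k` and `l` have only
            -- each other left, and likewise `y` and `z`.
            C∩Y′ : All (λ w → ¬ C w) Y′
            C∩Y′ = (λ Cv → proj₂ (und Cv) (here (inj₁ refl))) ∷ ¬C-v v~a ∷
                   ¬C-a (~-sym t~a) ∷ atMostOneNeighbour md fromK ∷ atMostOneNeighbour md fromL ∷
                   ¬C-a (~-sym x~a) ∷ atMostOneNeighbour md fromY ∷ atMostOneNeighbour md fromZ ∷ []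

          twoTriangles : Reduction S Y′ (v ∷ a ∷ [])
          twoTriangles = record
            { Y⊆S = v∈S ∷ a∈S ∷ T⊆S Tt ∷ T⊆S Tk ∷ T⊆S Tl ∷ x∈S ∷ y∈S ∷ z∈S ∷ []
            ; unique =
                (~⇒≢ v~a ∷ v≢T Tt ∷ v≢T Tk ∷ v≢T Tl ∷ v≢ #0 ∷ v≢ #1 ∷ v≢ #2 ∷ []) ∷
                (≢-sym (~⇒≢ t~a) ∷ ≢-sym (≢T Tk #3) ∷ ≢-sym (≢T Tl #3) ∷
                  neighbour≢ v~a #0 ∷ neighbour≢ v~a #1 ∷ neighbour≢ v~a #2 ∷ []) ∷
                (~⇒≢ t~k ∷ ~⇒≢ t~l ∷ ≢T Tt #0 ∷ ≢T Tt #1 ∷ ≢T Tt #2 ∷ []) ∷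
                (~⇒≢ k~l ∷ ≢T Tk #0 ∷ ≢T Tk #1 ∷ ≢T Tk #2 ∷ []) ∷
                (≢T Tl #0 ∷ ≢T Tl #1 ∷ ≢T Tl #2 ∷ []) ∷
                (~⇒≢ x~y ∷ ~⇒≢ x~z ∷ []) ∷ (~⇒≢ y~z ∷ []) ∷ [] ∷ []
            ; size = ≤-refl
            ; nonempty = s≤s z≤n
            ; avoids = C∩Y′
            }

          -- Outside `Y′` the two triangles can only have the neighbours `p` and `q`, which `v`
          -- dominates.
          no-survivor : ¬ Survivor S Y′ (v ∷ a ∷ [])
          no-survivor s′ with Survivor.exit s′
          ... | here u~v         = Survivor.¬dominated s′ (here refl) (here (inj₂ (~-sym u~v)))
          ... | there (here u~a) = Survivor.¬dominated s′ (here refl) (there (here (inj₂ (~-sym u~a))))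
          ... | there (there u~) with entry
                (fromTriangle Tt ∷ fromTriangle Tk ∷ fromTriangle Tl ∷ All.map fromH nbhd)
                                            (Survivor.T⊆S s′ (here refl)) u~
            where
            fromTriangle : ∀ {u} → T u → Nbhd⊆ S u (p ∷ q ∷ Y′)
            fromTriangle Tu w w∈S u~w with neighbour Tu w∈S u~w
            ... | inj₁ Tw = there (there (there (there (++⁺ˡ (T⊆ Tw)))))
            ... | inj₂ #0 = there (there #5)
            ... | inj₂ #1 = there (there #6)
            ... | inj₂ #2 = there (there #7)
            ... | inj₂ #3 = #3
            fromH : ∀ {u} → Nbhd⊆ S u (a ∷ p ∷ q ∷ x ∷ y ∷ z ∷ []) → Nbhd⊆ S u (p ∷ q ∷ Y′)
            fromH nb w w∈S u~w with nb w w∈S u~w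
            ... | #0 = #3
            ... | #1 = #0
            ... | #2 = #1
            ... | there (there (there w∈)) = ++⁺ʳ (p ∷ q ∷ v ∷ a ∷ t ∷ k ∷ l ∷ []) w∈
          ...   | #0 = Survivor.¬dominated s′ (here refl) (here (inj₂ v~p))
          ...   | #1 = Survivor.¬dominated s′ (here refl) (here (inj₂ v~q))
          ...   | there (there u∈Y′) = Survivor.T∩Y s′ (here refl) u∈Y′

        isolable : QuarterIsolable S
        isolable with exit
        ... | here t~x                         = contradiction t~x (separate (here refl) #0)
        ... | there (here t~y)                 = contradiction t~y (separate (here refl) #1)
        ... | there (there (here t~z))         = contradiction t~z (separate (here refl) #2)
        ... | there (there (there (here t~a))) with others (here refl)
        ...   | _ , _ , Tk , Tl , t~k , t~l , k~l =
          attempt (twoTriangles (here refl) Tk Tl t~k t~l k~l t~a)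
                  λ s′ → contradiction s′ (no-survivor (here refl) Tk Tl t~k t~l k~l t~a)

      isolable : QuarterIsolable S
      isolable = attempt (star x∈S (y∈S ∷ z∈S ∷ a∈S ∷ [])
                    ((~⇒≢ x~y ∷ ~⇒≢ x~z ∷ ~⇒≢ x~a ∷ []) ∷
                     (~⇒≢ y~z ∷ ≢-sym (neighbour≢ v~a #1) ∷ []) ∷ (≢-sym (neighbour≢ v~a #2) ∷ []) ∷ [] ∷ [])
                    ≤-refl (x~y ∷ x~z ∷ x~a ∷ [])) split
        where
        split : Survivor S Y (x ∷ []) → QuarterIsolable S
        split s with Survivor.T? s v
        ... | yes Tv = Near.isolable s Tv
        ... | no ¬Tv = Far.isolable s ¬Tv

    claw : ∀ {v a p q} → v ∈ S → a ∈ S → p ∈ S → q ∈ S → v ~ a → v ~ p → v ~ q →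
           a ≢ p → a ≢ q → p ≢ q → QuarterIsolable S
    claw {v} {a} {p} {q} v∈S a∈S p∈S q∈S v~a v~p v~q a≢p a≢q p≢q =
      attempt (star v∈S (a∈S ∷ p∈S ∷ q∈S ∷ [])
                ((~⇒≢ v~a ∷ ~⇒≢ v~p ∷ ~⇒≢ v~q ∷ []) ∷ (a≢p ∷ a≢q ∷ []) ∷ (p≢q ∷ []) ∷ [] ∷ [])
                ≤-refl (v~a ∷ v~p ∷ v~q ∷ [])) fromTriangle
      where
      fromTriangle : Survivor S (v ∷ a ∷ p ∷ q ∷ []) (v ∷ []) → QuarterIsolable S
      fromTriangle s with Survivor.exit s | Survivor.others s (here refl)
      ... | here t~v | _ = contradiction (here (inj₂ (~-sym t~v))) (Survivor.¬dominated s (here refl))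
      ... | there exit | y , z , Ty , Tz , x~y , x~z , y~z = choose exit
        where
        open Survivor s hiding (exit)
        x : Fin n
        x = t₁
        Tx : T x
        Tx = here refl
        far : ∀ {u} → u ∈ˡ x ∷ y ∷ z ∷ [] → ¬ Dominated (v ∷ []) u
        far #0 = ¬dominated Tx
        far #1 = ¬dominated Ty
        far #2 = ¬dominated Tz
        nbhd : ∀ {u} → T u → Nbhd⊆ S u (a ∷ p ∷ q ∷ x ∷ y ∷ z ∷ [])
        nbhd Tu w w∈S u~w with neighbour Tu w∈S u~w
        ... | inj₁ Tw = ++⁺ʳ (a ∷ p ∷ q ∷ []) (three Tx Ty Tz (~⇒≢ x~y) (~⇒≢ x~z) (~⇒≢ y~z) Tw)
        ... | inj₂ #0 = contradiction (here (inj₂ (~-sym u~w))) (¬dominated Tu)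
        ... | inj₂ (there w∈) = ++⁺ˡ w∈
        nbhds : All (λ u → Nbhd⊆ S u (a ∷ p ∷ q ∷ x ∷ y ∷ z ∷ [])) (x ∷ y ∷ z ∷ [])
        nbhds = nbhd Tx ∷ nbhd Ty ∷ nbhd Tz ∷ []
        resp : ∀ {L} → a ∷ p ∷ q ∷ x ∷ y ∷ z ∷ [] ↭ L → All (λ u → Nbhd⊆ S u L) (x ∷ y ∷ z ∷ [])
        resp σ = All.map (λ nb w w∈S u~w → ∈-resp-↭ σ (nb w w∈S u~w)) nbhds
        -- The neighbours `a`, `p`, `q` of `v` are interchangeable; the one adjacent to `x` takes
        -- the place of `a`.
        choose : Any (x ~_) (a ∷ p ∷ q ∷ []) → QuarterIsolable S
        choose (here x~a) =
          Claw.isolable a∈S v∈S p∈S q∈S (T⊆S Tx) (T⊆S Ty) (T⊆S Tz) v~a v~p v~q a≢p a≢q p≢q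
            x~a x~y x~z y~z nbhds far
        choose (there (here x~p)) =
          Claw.isolable p∈S v∈S a∈S q∈S (T⊆S Tx) (T⊆S Ty) (T⊆S Tz) v~p v~a v~q (≢-sym a≢p) p≢q a≢q
            x~p x~y x~z y~z (resp (swap a p ↭-refl)) far
        choose (there (there (here x~q))) =
          Claw.isolable q∈S v∈S a∈S p∈S (T⊆S Tx) (T⊆S Ty) (T⊆S Tz) v~q v~a v~p (≢-sym a≢q) (≢-sym p≢q) a≢p
            x~q x~y x~z y~z (resp (↭-trans (prep a (swap p q ↭-refl)) (swap a q ↭-refl))) far

    -- Maximum degree two.

    module MaxDegree2
      (small : ∀ {v a b c} → v ∈ S → a ∈ S → b ∈ S → c ∈ S → v ~ a → v ~ b → v ~ c →
               a ≢ b → a ≢ c → ¬ b ≢ c) where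

      -- The vertex with the exit edge would have three neighbours: two in its triangle and one in
      -- `Y`.
      no-survivor : ∀ {Y D} → All (_∈ S) Y → ¬ Survivor S Y D
      no-survivor Y⊆S s with Survivor.others s (here refl) | All.lookupAny Y⊆S (Survivor.exit s)
      ... | x , y , Tx , Ty , t~x , t~y , x~y | w∈S , t~w =
        small (T⊆S (here refl)) (T⊆S Tx) (T⊆S Ty) w∈S t~x t~y t~w (~⇒≢ x~y)
              (avoids Tx) (avoids Ty)
        where
        open Survivor s
        avoids : ∀ {u} → T u → u ≢ Any.lookup exit
        avoids Tu = All.lookupAny (T∉Y Tu) exit .proj₁

      leaf : ∀ {u} → u ∈ S → (∀ {a b} → a ∈ S → b ∈ S → u ~ a → u ~ b → ¬ a ≢ b) → QuarterIsolable S
      leaf u∈S one = attempt record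
        { Y⊆S      = u∈S ∷ []
        ; unique   = [] ∷ []
        ; size     = z≤n
        ; nonempty = s≤s z≤n
        ; avoids   = λ md und → (λ Cu → avoid md und Cu) ∷ []
        } λ s → contradiction s (no-survivor (u∈S ∷ []))
        where
        avoid : ∀ {C} → MinDegree2 C → Undominated S [] C → ¬ C _
        avoid md und Cu with md Cu
        ... | _ , _ , Ca , Cb , u~a , u~b , a≢b = one (proj₁ (und Ca)) (proj₁ (und Cb)) u~a u~b a≢b

      -- On the path `b`, `u`, `a`, `c` the vertex `u` dominates all but `c`, and `c` has at most
      -- one neighbour besides `a`.
      path : ∀ {u a b c} → u ∈ S → a ∈ S → b ∈ S → c ∈ S → u ~ a → u ~ b → a ~ c → a ≢ b → c ≢ u →
             ¬ a ~ b → QuarterIsolable S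
      path {u} {a} {b} {c} u∈S a∈S b∈S c∈S u~a u~b a~c a≢b c≢u a≁b = attempt record
        { Y⊆S      = Y⊆S
        ; unique   = (~⇒≢ u~a ∷ ~⇒≢ u~b ∷ ≢-sym c≢u ∷ []) ∷ (a≢b ∷ ~⇒≢ a~c ∷ []) ∷
                     ((λ { refl → a≁b a~c }) ∷ []) ∷ [] ∷ []
        ; size     = ≤-refl
        ; nonempty = s≤s z≤n
        ; avoids   = λ md und →
            (λ Cu → proj₂ (und Cu) (here (inj₁ refl))) ∷ (λ Ca → proj₂ (und Ca) (here (inj₂ u~a))) ∷
            (λ Cb → proj₂ (und Cb) (here (inj₂ u~b))) ∷ avoid-c md und ∷ []
        } λ s → contradiction s (no-survivor Y⊆S)
        where
        Y⊆S : All (_∈ S) (u ∷ a ∷ b ∷ c ∷ [])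
        Y⊆S = u∈S ∷ a∈S ∷ b∈S ∷ c∈S ∷ []
        avoid-c : ∀ {C} → MinDegree2 C → Undominated S (u ∷ []) C → ¬ C c
        avoid-c {C} md und Cc with md Cc
        ... | d , e , Cd , Ce , c~d , c~e , d≢e =
          small c∈S a∈S (proj₁ (und Cd)) (proj₁ (und Ce)) (~-sym a~c) c~d c~e (a≢ Cd) (a≢ Ce) d≢e
          where
          a≢ : ∀ {w} → C w → a ≢ w
          a≢ Cw refl = proj₂ (und Cw) (here (inj₂ u~a))

      TwoNeighbours : Fin n → Set
      TwoNeighbours u = ∃₂ λ a b → a ∈ S × b ∈ S × u ~ a × u ~ b × a ≢ b

      twoNeighbours? : ∀ u → Dec (TwoNeighbours u)
      twoNeighbours? u = any? λ a → any? λ b →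
        (a ∈? S) ×-dec (b ∈? S) ×-dec (u ~? a) ×-dec (u ~? b) ×-dec ¬? (a ≟ᶠ b)

      -- If `a ~ b`, the degree bound makes `uab` a triangle component of `S`, contrary to `none`.
      -- Otherwise one of the two neighbours of `a` differs from `u` and extends `b`, `u`, `a` to a
      -- path on four vertices.
      cycle : (∀ {u} → u ∈ S → TwoNeighbours u) → ∀ {u} → u ∈ S → QuarterIsolable S
      cycle two {u} u∈S with two u∈S
      ... | a , b , a∈S , b∈S , u~a , u~b , a≢b with a ~? b
      ...   | yes a~b = contradiction
              (corner u∈S b∈S a∈S u~a u~b (≢-sym a≢b) , corner a∈S u∈S b∈S a~b (~-sym u~a) (~⇒≢ u~b) ,
               corner b∈S a∈S u∈S (~-sym u~b) (~-sym a~b) (≢-sym (~⇒≢ u~a))) none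
        where
        corner : ∀ {u a b} → u ∈ S → b ∈ S → a ∈ S → u ~ a → u ~ b → b ≢ a → Corner S [] u a b
        corner {u} {a} {b} u∈S b∈S a∈S u~a u~b b≢a = u∈S , [] , u~a , nbhd
          where
          nbhd : Nbhd⊆ S u (a ∷ b ∷ [])
          nbhd w w∈S u~w with w ≟ᶠ a | w ≟ᶠ b
          ... | yes refl | _ = #0
          ... | _ | yes refl = #1
          ... | no w≢a | no w≢b =
            contradiction (≢-sym b≢a) (small u∈S w∈S a∈S b∈S u~w u~a u~b w≢a w≢b)
      ...   | no a≁b with two a∈S
      ...     | c , d , c∈S , d∈S , a~c , a~d , c≢d with c ≟ᶠ u
      ...       | no c≢u   = path u∈S a∈S b∈S c∈S u~a u~b a~c a≢b c≢u a≁b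
      ...       | yes refl = path u∈S a∈S b∈S d∈S u~a u~b a~d a≢b (≢-sym c≢d) a≁b

      isolable : QuarterIsolable S
      isolable with any? (_∈? S) | any? (λ u → (u ∈? S) ×-dec ¬? (twoNeighbours? u))
      ... | no empty | _ = [] , z≤n , λ _ und Cu → empty (_ , proj₁ (und Cu))
      ... | _ | yes (u , u∈S , ¬two) =
        leaf u∈S λ a∈S b∈S u~a u~b a≢b → ¬two (_ , _ , a∈S , b∈S , u~a , u~b , a≢b)
      ... | yes (u , u∈S) | no ¬leaf =
        cycle (λ {w} w∈S → decidable-stable (twoNeighbours? w) λ ¬two → ¬leaf (_ , w∈S , ¬two)) u∈S

    step : QuarterIsolable S
    step with any? (λ v → any? λ a → any? λ b → any? λ c →
      (v ∈? S) ×-dec (a ∈? S) ×-dec (b ∈? S) ×-dec (c ∈? S) ×-dec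
      (v ~? a) ×-dec (v ~? b) ×-dec (v ~? c) ×-dec ¬? (a ≟ᶠ b) ×-dec ¬? (a ≟ᶠ c) ×-dec ¬? (b ≟ᶠ c))
    ... | yes (_ , _ , _ , _ , v∈S , a∈S , b∈S , c∈S , v~a , v~b , v~c , a≢b , a≢c , b≢c) =
      claw v∈S a∈S b∈S c∈S v~a v~b v~c a≢b a≢c b≢c
    ... | no ¬claw = MaxDegree2.isolable λ v∈S a∈S b∈S c∈S v~a v~b v~c a≢b a≢c b≢c →
      ¬claw (_ , _ , _ , _ , v∈S , a∈S , b∈S , c∈S , v~a , v~b , v~c , a≢b , a≢c , b≢c)

  quarterIsolable : ∀ S → NoTriangleComponent S → QuarterIsolable S
  quarterIsolable S = go S (<-wellFounded ∣ S ∣)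
    where
    go : ∀ S → Acc _<_ ∣ S ∣ → NoTriangleComponent S → QuarterIsolable S
    go S (acc rec) none = Step.step none λ {S′} S′<S → go S′ (rec S′<S)

-- The upper bound for `ιc`.

module _ (G : Graph (Fin n)) where
  open Graph G

  module _ {D : Subset n} (c : Cycle (G -N[ D ])) where
    open Cycle c

    private
      f : Fin (suc k) → Fin n
      f i = value (vertex i)

      f-injective : ∀ {i j} → f i ≡ f j → i ≡ j
      f-injective eq = injective (value-injective eq)
        where
        value-injective : ∀ {u v : Refinement (Fin n) (λ u → ¬ ⋃N[ G ] D u)} → value u ≡ value v → u ≡ v
        value-injective refl = refl

    cycleVertices : Pred (Fin n) 0ℓ
    cycleVertices u = ∃ λ i → f i ≡ u

    cycleVertices-undominated : ∀ {u} → cycleVertices u → ¬ ⋃N[ G ] D u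
    cycleVertices-undominated (i , refl) with vertex i
    ... | u ,ᵣ [ p ] = recompute (¬? (⋃N? G D u)) p

    cycleVertices-minDegree2 : MinDegree2 G cycleVertices
    cycleVertices-minDegree2 (i , refl)
      with cyclicNeighbours {R = λ i j → f i ~ f j} ~-sym 2≤k step close i
    ... | a , b , i~a , i~b , a≢b =
      f a , f b , (a , refl) , (b , refl) , i~a , i~b , a≢b ∘ f-injective

  -- The vertices of a cycle that `D` misses form a set of minimum degree two, which `iso` refutes.
  isolates⇒ιc≤length : ∀ {D} → Isolates G D ⊤ → ιc G ≤ length D
  isolates⇒ιc≤length {D} iso = ≤-trans
    (proj₂ (ιc-isLeast G) _ (fromList D , isolating , refl)) (∣fromList∣≤length D)
    where
    dominated : ∀ {u} → Dominated G D u → ⋃N[ G ] (fromList D) u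
    dominated dom with find dom
    ... | d , d∈D , nbhd = d , ∈-fromList d∈D , nbhd
    isolating : CycleIsolating G (fromList D)
    isolating c = iso (cycleVertices-minDegree2 c)
      (λ Cu → ∈⊤ , cycleVertices-undominated c Cu ∘ dominated) (zero , refl)

  -- By connectedness the triangle would contain every vertex.
  connected⇒noTriangleComponent : Connected G → 4 ≤ n → NoTriangleComponent G ⊤
  connected⇒noTriangleComponent conn 4≤n {a} {b} {c}
    ((_ , _ , _ , nbhd-a) , (_ , _ , _ , nbhd-b) , (_ , _ , _ , nbhd-c)) =
    <⇒≱ 4≤n (begin
      n                                    ≡⟨ ∣⊤∣≡n n ⟨
      ∣ ⊤ {n} ∣                            ≤⟨ p⊆q⇒∣p∣≤∣q∣ {p = ⊤} (λ {u} _ →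
                                                ∈-fromList (reach (conn a u) (here refl))) ⟩
      ∣ fromList (a ∷ b ∷ c ∷ []) ∣        ≤⟨ ∣fromList∣≤length (a ∷ b ∷ c ∷ []) ⟩
      3                                    ∎)
    where
    open ≤-Reasoning
    reach : ∀ {u v} → Star _~_ u v → u ∈ˡ a ∷ b ∷ c ∷ [] → v ∈ˡ a ∷ b ∷ c ∷ []
    reach ε u∈ = u∈
    reach (u~w ◅ path) #0 = reach path (there (nbhd-a _ ∈⊤ u~w))
    reach (u~w ◅ path) #1 = reach path (rotate-Any G (rotate-Any G (there (nbhd-b _ ∈⊤ u~w))))
    reach (u~w ◅ path) #2 = reach path (rotate-Any G (there (nbhd-c _ ∈⊤ u~w)))

  4*ιc≤n : Connected G → 4 ≤ n → 4 * ιc G ≤ n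
  4*ιc≤n conn 4≤n with quarterIsolable G ⊤ (connected⇒noTriangleComponent conn 4≤n)
  ... | D , size , iso =
    ≤-trans (*-monoʳ-≤ 4 (isolates⇒ιc≤length iso)) (subst (4 * length D ≤_) (∣⊤∣≡n n) size)

4*ιcMax≤n : ∀ n → .{{_ : NonZero n}} → 4 ≤ n → 4 * ιcMax n ≤ n
4*ιcMax≤n n 4≤n with ιcMax-isGreatest n
... | (G , conn , _ , eq) , _ = subst (λ k → 4 * k ≤ n) eq (4*ιc≤n G conn 4≤n)

-- The lower bound.

-- m copies of K₄ whose vertices of index zero (hubs) form a clique. The other three vertices
-- of a copy have no neighbours outside it, so an isolating set meets every copy.
module _ (m : ℕ) where

  private
    Link : Fin m × Fin 4 → Fin m × Fin 4 → Set
    Link (i , j) (i′ , j′) = (i ≡ i′ × j ≢ j′) ⊎ (i ≢ i′ × j ≡ zero × j′ ≡ zero)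

    link? : ∀ u v → Dec (Link u v)
    link? (i , j) (i′ , j′) =
      ((i ≟ᶠ i′) ×-dec ¬? (j ≟ᶠ j′)) ⊎-dec (¬? (i ≟ᶠ i′) ×-dec (j ≟ᶠ zero) ×-dec (j′ ≟ᶠ zero))

  hubbedK₄s : Graph (Fin (m * 4))
  hubbedK₄s = record
    { _~_      = λ u v → Link (remQuot 4 u) (remQuot 4 v)
    ; _~?_     = λ u v → link? (remQuot 4 u) (remQuot 4 v)
    ; ~-sym    = λ { (inj₁ (i≡ , j≢)) → inj₁ (sym i≡ , ≢-sym j≢)
                   ; (inj₂ (i≢ , j≡ , j′≡)) → inj₂ (≢-sym i≢ , j′≡ , j≡) }
    ; ~-irrefl = λ { refl (inj₁ (_ , j≢)) → j≢ refl ; refl (inj₂ (i≢ , _)) → i≢ refl }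
    }

  open Graph hubbedK₄s

  private
    link⇒~ : ∀ {i j i′ j′} → Link (i , j) (i′ , j′) → combine i j ~ combine i′ j′
    link⇒~ {i} {j} {i′} {j′} = subst₂ Link (sym (remQuot-combine i j)) (sym (remQuot-combine i′ j′))

    toHub : ∀ (i : Fin m) (j : Fin 4) → Star _~_ (combine i j) (combine i zero)
    toHub i zero    = ε
    toHub i (suc j) = link⇒~ (inj₁ (refl , λ ())) ◅ ε

    betweenHubs : ∀ (i i′ : Fin m) → Star _~_ (combine i zero) (combine i′ zero)
    betweenHubs i i′ with i ≟ᶠ i′
    ... | yes refl = ε
    ... | no  i≢i′ = link⇒~ (inj₂ (i≢i′ , refl , refl)) ◅ ε

  hubbedK₄s-connected : Connected hubbedK₄s
  hubbedK₄s-connected u v = subst₂ (Star _~_) (combine-remQuot {m} 4 u) (combine-remQuot {m} 4 v)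
    (toHub i j ◅◅ betweenHubs i i′ ◅◅ reverse ~-sym (toHub i′ j′))
    where
    i = proj₁ (remQuot {m} 4 u)
    j = proj₂ (remQuot {m} 4 u)
    i′ = proj₁ (remQuot {m} 4 v)
    j′ = proj₂ (remQuot {m} 4 v)

  -- If `D` missed a copy, its three vertices other than the hub would be an undominated triangle;
  -- `suc j` skips the hub.
  meetsEveryK₄ : ∀ {D} → CycleIsolating hubbedK₄s D → ∀ i → ∃ λ j → combine i j ∈ D
  meetsEveryK₄ {D} iso i = decidable-stable (any? λ j → combine i j ∈? D) λ missed → iso record
    { 2≤k       = ≤-refl
    ; vertex    = λ j → combine i (suc j) ,ᵣ [ undominated missed j ]
    ; injective = λ eq → suc-injective (combine-injectiveʳ i _ i _ (cong value eq))
    ; step      = λ { zero → link⇒~ (inj₁ (refl , λ ())) ; (suc zero) → link⇒~ (inj₁ (refl , λ ())) }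
    ; close     = link⇒~ (inj₁ (refl , λ ()))
    }
    where
    undominated : ¬ (∃ λ j → combine i j ∈ D) → ∀ j → ¬ ⋃N[ hubbedK₄s ] D (combine i (suc j))
    undominated missed j (v , v∈D , inj₁ refl) = missed (_ , v∈D)
    undominated missed j (v , v∈D , inj₂ v~u)
      with subst (Link (remQuot 4 v)) (remQuot-combine i (suc j)) v~u
    ... | inj₁ (refl , _) = missed (_ , subst (_∈ D) (sym (combine-remQuot {m} 4 v)) v∈D)

  -- One vertex of `D` is picked from each copy; the copies are disjoint.
  m≤ιc : m ≤ ιc hubbedK₄s
  m≤ιc with ιc-isLeast hubbedK₄s
  ... | (D , iso , eq) , _ = begin
    m                          ≡⟨ length-tabulate hit ⟨
    length (tabulateˡ hit)     ≤⟨ unique∧⊆⇒length≤ (Unique-tabulate⁺ λ {i} {i′} → combine-injectiveˡ i _ i′ _)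
                                                   (All-tabulate⁺ (proj₂ ∘ meetsEveryK₄ iso)) ⟩
    ∣ D ∣                      ≡⟨ eq ⟩
    ιc hubbedK₄s               ∎
    where
    open ≤-Reasoning
    hit : Fin m → Fin (m * 4)
    hit i = combine i (proj₁ (meetsEveryK₄ iso i))

m≤ιcMax[m*4] : ∀ m → .{{_ : NonZero (m * 4)}} → m ≤ ιcMax (m * 4)
m≤ιcMax[m*4] m = ≤-trans (m≤ιc m) (proj₂ (ιcMax-isGreatest (m * 4)) _
  (hubbedK₄s m , hubbedK₄s-connected m , ≇K₃ , refl))
  where
  ≇K₃ : ¬ (hubbedK₄s m ≅ K 3)
  ≇K₃ i = 4∤3 m (↔⇒≡ (_≅_.bijection i))
    where
    4∤3 : ∀ m → m * 4 ≢ 3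
    4∤3 zero    ()
    4∤3 (suc m) ()

-- The limit superior.

-- The order of unnormalised rationals is cross-multiplication by definition, so the detour through
-- them avoids reduction to lowest terms.
/-mono-≤ : ∀ k m l n .{{_ : NonZero m}} .{{_ : NonZero n}} → k * n ≤ l * m → + k / m ≤ℚ + l / n
/-mono-≤ k (suc m) l (suc n) le = ℚ.toℚᵘ-cancel-≤ (begin
  ℚ.toℚᵘ (+ k / suc m)  ≃⟨ ℚ.toℚᵘ-fromℚᵘ (mkℚᵘ (+ k) m) ⟩
  mkℚᵘ (+ k) m          ≤⟨ *≤* (subst₂ ℤ._≤_ (pos-* k (suc n)) (pos-* l (suc m)) (ℤ.+≤+ le)) ⟩
  mkℚᵘ (+ l) n          ≃⟨ ℚ.toℚᵘ-fromℚᵘ (mkℚᵘ (+ l) n) ⟨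
  ℚ.toℚᵘ (+ l / suc n)  ∎)
  where open ℚᵘ.≤-Reasoning

p<p+δ : ∀ p {δ} → 0ℚ <ℚ δ → p <ℚ p ℚ.+ δ
p<p+δ p 0<δ = subst (_<ℚ p ℚ.+ _) (ℚ.+-identityʳ p) (ℚ.+-monoʳ-< p 0<δ)

p-δ<p : ∀ p {δ} → 0ℚ <ℚ δ → p ℚ.- δ <ℚ p
p-δ<p p 0<δ = subst (p ℚ.- _ <ℚ_) (ℚ.+-identityʳ p) (ℚ.+-monoʳ-< p (ℚ.neg-antimono-< 0<δ))

corollary1p4 : LimSup ιcRatio (+ 1 / 4)
corollary1p4 δ 0<δ =
  -- The threshold does not depend on `δ`: from 4 on the ratio is at most `1/4`.
  (4 , λ n 4≤n → ℚ.≤-<-trans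
    (/-mono-≤ (ιcMax n) n 1 4 (subst₂ _≤_ (*-comm 4 (ιcMax n)) (sym (*-identityˡ n)) (4*ιcMax≤n n 4≤n)))
    (p<p+δ (+ 1 / 4) 0<δ)) ,
  -- At multiples of 4 the ratio is at least `1/4`; `suc` keeps the multiple nonzero when `N` is
  -- zero.
  λ N → suc N * 4 , _ , ≤-trans (n≤1+n N) (m≤m*n (suc N) 4) ,
    ℚ.<-≤-trans (p-δ<p (+ 1 / 4) 0<δ)
      (/-mono-≤ 1 4 (ιcMax (suc N * 4)) (suc N * 4)
        (subst (_≤ ιcMax (suc N * 4) * 4) (sym (*-identityˡ (suc N * 4)))
                  (*-monoˡ-≤ 4 (m≤ιcMax[m*4] (suc N)))))
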